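{- Let $G$ be a connected multigraph (multiple edges allowed, no loops) with maximum degree $\Delta(G)$, and let $k$ be a non-negative integer such that $\Delta(L(G))\le\Delta(G)+k$, where $L(G)$ is the line graph of $G$. Let the palette be $\mathcal{K}=\{1,\dots,\Delta(G)+k\}$. Let $S\subseteq E(G)$ carry a proper edge-colouring with colours from $\mathcal{K}$ such that every vertex of $G$ is incident with at most $k$ edges of $S$. Suppose that neither of the following holds: (a) $k=0$ and $G$ is a simple odd cycle; (b) $G$ has exactly three vertices, every pair of them is joined by at least one edge, the three pairs have edge multiplicities $m_1,m_2,m_3$, and $k=\min\{m_1,m_2,m_3\}-1$. Then the precolouring of $S$ can be extended to a proper edge-colouring of all of $G$ using only colours from $\mathcal{K}$.
   Context: The line graph $L(G)$ of a multigraph has the edges of $G$ as vertices, two being adjacent iff they share an end-vertex (parallel edges are adjacent). A proper edge-colouring assigns colours to edges so that any two edges sharing an end-vertex receive distinct colours. Extending a precolouring means producing a proper edge-colouring of all of $G$ agreeing with the given colours on $S$. -}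

module Defs where

open import Data.Nat using (ℕ; zero; suc; _+_; _∸_; _≤_; _⊔_; _⊓_)
open import Data.Nat.Properties using ()
open import Data.Fin using (Fin; toℕ; _≟_)
open import Data.List using (List; length; filterᵇ; map; foldr; allFin)
open import Data.Bool using (Bool; _∧_; _∨_; not)
open import Data.Maybe using (Maybe; just; is-just)
open import Data.Product using (Σ; ∃; _×_; _,_; proj₁; proj₂)
open import Data.Sum using (_⊎_)
open import Relation.Nullary using (¬_)
open import Relation.Nullary.Decidable using (⌊_⌋)
open import Relation.Binary.PropositionalEquality using (_≡_; _≢_)
open import Function.Bundles using (_↔_; Inverse)

record Multigraph : Set where
  field
    n     : ℕ
    m     : ℕ
    ends  : Fin m → Fin n × Fin n
    loopless : ∀ e → proj₁ (ends e) ≢ proj₂ (ends e)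

module _ (G : Multigraph) where
  open Multigraph G

  Inc : Fin m → Fin n → Set
  Inc e v = (proj₁ (ends e) ≡ v) ⊎ (proj₂ (ends e) ≡ v)

  incᵇ : Fin m → Fin n → Bool
  incᵇ e v = ⌊ proj₁ (ends e) ≟ v ⌋ ∨ ⌊ proj₂ (ends e) ≟ v ⌋

  countE : (Fin m → Bool) → ℕ
  countE p = length (filterᵇ p (allFin m))

  degree : Fin n → ℕ
  degree v = countE (λ e → incᵇ e v)

  Δ : ℕ
  Δ = foldr _⊔_ 0 (map degree (allFin n))

  AdjL : Fin m → Fin m → Set
  AdjL e f = (e ≢ f) × (Σ (Fin n) λ v → Inc e v × Inc f v)

  adjLᵇ : Fin m → Fin m → Bool
  adjLᵇ e f = not ⌊ e ≟ f ⌋ ∧ (incᵇ f (proj₁ (ends e)) ∨ incᵇ f (proj₂ (ends e)))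

  degreeL : Fin m → ℕ
  degreeL e = countE (adjLᵇ e)

  ΔL : ℕ
  ΔL = foldr _⊔_ 0 (map degreeL (allFin m))

  data Reach : Fin n → Fin n → Set where
    here : ∀ {v} → Reach v v
    step : ∀ {u w v} (e : Fin m) →
           ((ends e ≡ (u , w)) ⊎ (ends e ≡ (w , u))) → Reach w v → Reach u v

  Connected : Set
  Connected = ∀ u v → Reach u v

  mult : Fin n → Fin n → ℕ
  mult u v = countE (λ e → incᵇ e u ∧ incᵇ e v)

  Simple : Set
  Simple = ∀ e f → e ≢ f →
    ¬ ((ends e ≡ ends f) ⊎ (ends e ≡ (proj₂ (ends f) , proj₁ (ends f))))

  Consec : Fin n → Fin n → Set
  Consec i j = (toℕ j ≡ suc (toℕ i)) ⊎ ((suc (toℕ i) ≡ n) × (toℕ j ≡ 0))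

  -- G is a cycle: n ≥ 3 and there is a cyclic ordering σ of the vertices and
  -- a bijection τ between edges and positions such that edge e joins
  -- σ (τ e) and σ (τ e + 1 mod n).
  IsCycle : Set
  IsCycle = (3 ≤ n) × Σ (Fin n ↔ Fin n) λ σ → Σ (Fin m ↔ Fin n) λ τ →
    ∀ e i j → Inverse.to τ e ≡ i → Consec i j →
      (ends e ≡ (Inverse.to σ i , Inverse.to σ j)) ⊎
      (ends e ≡ (Inverse.to σ j , Inverse.to σ i))

  Odd : ℕ → Set
  Odd x = Σ ℕ λ t → x ≡ suc (t + t)

  ExceptionA : ℕ → Set
  ExceptionA k = (k ≡ 0) × Simple × IsCycle × Odd n

  ExceptionB : ℕ → Set
  ExceptionB k = (n ≡ 3) × Σ (Fin n) λ u → Σ (Fin n) λ v → Σ (Fin n) λ w →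
    (u ≢ v) × (u ≢ w) × (v ≢ w) ×
    (1 ≤ mult u v) × (1 ≤ mult u w) × (1 ≤ mult v w) ×
    (k + 1 ≡ mult u v ⊓ mult u w ⊓ mult v w)

  ProperColouring : (K : ℕ) → (Fin m → Fin K) → Set
  ProperColouring K c = ∀ e f → AdjL e f → c e ≢ c f

  -- a precolouring: S = set of edges e with pc e ≡ just _
  ProperPrecolouring : (K : ℕ) → (Fin m → Maybe (Fin K)) → Set
  ProperPrecolouring K pc = ∀ e f a b → AdjL e f →
    pc e ≡ just a → pc f ≡ just b → a ≢ b

  SBounded : (K k : ℕ) → (Fin m → Maybe (Fin K)) → Set
  SBounded K k pc = ∀ v → countE (λ e → incᵇ e v ∧ is-just (pc e)) ≤ k

  Extends : (K : ℕ) → (Fin m → Maybe (Fin K)) → (Fin m → Fin K) → Set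
  Extends K pc c = ∀ e a → pc e ≡ just a → c e ≡ a

{-# OPTIONS --safe #-}
-- Colour the line graph of the uncoloured edges greedily from lists. An
-- uncoloured edge always has at least as many available colours as uncoloured
-- neighbours; call it slack if it has more. A connected set of uncoloured edges
-- containing a slack edge can be coloured towards it. If no edge is slack, then
-- every uncoloured edge uv has degree Δ + k in the line graph, and as at most k
-- coloured edges meet u, some uncoloured edge at u avoids v. Hence the
-- uncoloured edges contain a cycle C. A further uncoloured edge at C which is
-- not parallel to an edge of a triangle C makes the degrees in a small core
-- uneven, which permits colouring one core edge so that another becomes slack.
-- Otherwise all lists along C must agree, or again slack can be created. Then an
-- even C is coloured alternately; in an odd C of length at least 5 the colours
-- present at consecutive vertices alternate, so none is present, k = 0 and G is
-- an odd cycle; and if C is a triangle, every edge at C is parallel to an edge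
-- of C, so G is a triangle with multiple edges and k is determined by its degrees.
module Submission where

open import Defs
open import Algebra.Properties.CommutativeMonoid.Sum using ()
open import Data.Bool using (Bool; true; false; if_then_else_; _∧_; _∨_; not)
open import Data.Empty using (⊥; ⊥-elim)
open import Data.Fin using (Fin; zero; suc; toℕ; fromℕ<)
import Data.Fin as Fin
import Data.Fin.Properties as Fin
open import Data.List using (List; []; _∷_; _++_; length; filterᵇ; allFin; tabulate; map; foldr)
open import Data.List.Membership.Propositional using (_∈_; _∉_)
open import Data.List.Membership.Propositional.Properties using (∈-map⁺; ∈-map⁻; ∈-allFin; foldr-selective; ∈-++⁺ˡ; ∈-++⁺ʳ; ∈-++⁻)
open import Data.List.Properties using (++-identityʳ)
open import Data.List.Relation.Unary.All using (All; []; _∷_)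
import Data.List.Relation.Unary.All as All
open import Data.List.Relation.Unary.All.Properties using (All¬⇒¬Any; ¬Any⇒All¬; ++⁺)
open import Data.List.Relation.Unary.AllPairs using ([]; _∷_)
open import Data.List.Relation.Unary.Any using (here; there)
open import Data.List.Relation.Unary.Unique.Propositional using (Unique)
open import Data.Maybe using (Maybe; just; nothing; is-just)
open import Data.Maybe.Properties using (just-injective; ≡-dec)
open import Data.Nat using (ℕ; zero; suc; _+_; _∸_; _⊔_; _⊓_; _≤_; _<_; z≤n; s≤s; z<s; s<s; _<?_)
import Data.Nat as ℕ
import Data.Nat.Properties as ℕ
open import Data.Nat.Tactic.RingSolver using (solve-∀)
open import Data.Product using (Σ; ∃; ∃₂; _×_; _,_; proj₁; proj₂; swap)
open import Data.Sum using (_⊎_; inj₁; inj₂)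
import Data.Sum as Sum
open import Data.Vec.Functional using (updateAt) renaming (_∷_ to _∷ᶠ_)
open import Data.Vec.Functional.Properties using (updateAt-updates; updateAt-minimal)
open import Function using (_∘_; id; const)
open import Function.Bundles using (_↔_; mk↔ₛ′; Inverse)
open import Function.Properties.Inverse using (↔-sym)
open import Relation.Binary.Definitions using (tri<; tri≈; tri>)
open import Relation.Binary.PropositionalEquality
open import Relation.Nullary using (¬_; Dec; yes; no; does; contradiction)
open import Relation.Nullary.Decidable using (_×-dec_; _⊎-dec_; ¬?; decidable-stable; map′; dec-true; dec-false; _→-dec_; isYes≗does)
open import Relation.Unary using (Decidable)

open Algebra.Properties.CommutativeMonoid.Sum ℕ.+-0-commutativeMonoid
  using (sum; ∑-distrib-+; ∑-comm; sum-cong-≗; sum-replicate-zero)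

-- Counting

sum-mono : ∀ {n} {f g : Fin n → ℕ} → (∀ i → f i ≤ g i) → sum f ≤ sum g
sum-mono {zero}  _   = z≤n
sum-mono {suc n} f≤g = ℕ.+-mono-≤ (f≤g zero) (sum-mono (f≤g ∘ suc))

sum-mono-< : ∀ {n} {f g : Fin n → ℕ} → (∀ i → f i ≤ g i) → ∀ i → f i < g i → sum f < sum g
sum-mono-< f≤g zero    fi<gi = ℕ.+-mono-<-≤ fi<gi (sum-mono (f≤g ∘ suc))
sum-mono-< f≤g (suc i) fi<gi = ℕ.+-mono-≤-< (f≤g zero) (sum-mono-< (f≤g ∘ suc) i fi<gi)

sum-const-1 : ∀ n → sum {n} (const 1) ≡ n
sum-const-1 zero    = refl
sum-const-1 (suc n) = cong suc (sum-const-1 n)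

indicator : {P : Set} → Dec P → ℕ
indicator P? = if does P? then 1 else 0

indicator-yes : {P : Set} (P? : Dec P) → P → indicator P? ≡ 1
indicator-yes P? p rewrite dec-true P? p = refl

indicator-no : {P : Set} (P? : Dec P) → ¬ P → indicator P? ≡ 0
indicator-no P? ¬p rewrite dec-false P? ¬p = refl

indicator-mono : {P Q : Set} (P? : Dec P) (Q? : Dec Q) → (P → Q) → indicator P? ≤ indicator Q?
indicator-mono (yes p) (yes q) _   = ℕ.≤-refl
indicator-mono (yes p) (no ¬q) P⇒Q = contradiction (P⇒Q p) ¬q
indicator-mono (no _)  _       _   = z≤n

count : ∀ {n} {P : Fin n → Set} → Decidable P → ℕ
count P? = sum (indicator ∘ P?)

count-none : ∀ {n} {P : Fin n → Set} (P? : Decidable P) → (∀ i → ¬ P i) → count P? ≡ 0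
count-none {n} P? none = trans (sum-cong-≗ λ i → indicator-no (P? i) (none i)) (sum-replicate-zero n)

count-≡ : ∀ {n} (j : Fin n) → count (Fin._≟ j) ≡ 1
count-≡ {suc n} zero    = cong suc (sum-replicate-zero n)
count-≡         (suc j) = count-≡ j

module _ {n} {P Q : Fin n → Set} (P? : Decidable P) (Q? : Decidable Q) where

  count-mono : (∀ i → P i → Q i) → count P? ≤ count Q?
  count-mono P⇒Q = sum-mono λ i → indicator-mono (P? i) (Q? i) (P⇒Q i)

  count-mono-< : (∀ i → P i → Q i) → ∀ i → ¬ P i → Q i → count P? < count Q?
  count-mono-< P⇒Q i ¬p q = sum-mono-< (λ j → indicator-mono (P? j) (Q? j) (P⇒Q j)) i
    (subst₂ _<_ (sym (indicator-no (P? i) ¬p)) (sym (indicator-yes (Q? i) q)) z<s)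

  count-<⇒∃ : count P? < count Q? → ∃ λ i → Q i × ¬ P i
  count-<⇒∃ p<q with Fin.any? (λ i → Q? i ×-dec ¬? (P? i))
  ... | yes w = w
  ... | no ¬w = contradiction (sum-mono λ i → indicator-mono (Q? i) (P? i) λ q →
                  decidable-stable (P? i) λ ¬p → ¬w (i , q , ¬p)) (ℕ.<⇒≱ p<q)

  count-split : count P? ≡ count (λ i → P? i ×-dec Q? i) + count (λ i → P? i ×-dec ¬? (Q? i))
  count-split = trans (sum-cong-≗ λ i → pointwise (P? i) (Q? i)) (∑-distrib-+ {n} _ _)
    where
    pointwise : {A B : Set} (A? : Dec A) (B? : Dec B) →
      indicator A? ≡ indicator (A? ×-dec B?) + indicator (A? ×-dec ¬? B?)
    pointwise (yes _) (yes _) = refl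
    pointwise (yes _) (no _)  = refl
    pointwise (no _)  _       = refl

  count-≤-suc : ∀ j → (∀ i → P i → i ≢ j → Q i) → count P? ≤ suc (count Q?)
  count-≤-suc j h = ℕ.≤-trans (sum-mono λ i → pointwise (P? i) (Q? i) (i Fin.≟ j) (h i))
    (ℕ.≤-reflexive (trans (∑-distrib-+ {n} _ _) (cong (_+ count Q?) (count-≡ j))))
    where
    pointwise : {A B C : Set} (A? : Dec A) (B? : Dec B) (C? : Dec C) → (A → ¬ C → B) →
      indicator A? ≤ indicator C? + indicator B?
    pointwise (no _)  _       _       _ = z≤n
    pointwise (yes _) _       (yes _) _ = s≤s z≤n
    pointwise (yes a) (yes b) (no _)  _ = ℕ.≤-refl
    pointwise (yes a) (no ¬b) (no ¬c) f = contradiction (f a ¬c) ¬b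

0<count⇒∃ : ∀ {n} {P : Fin n → Set} (P? : Decidable P) → 0 < count P? → ∃ P
0<count⇒∃ P? 0<c with Fin.any? P?
... | yes w = w
... | no ¬w = contradiction (ℕ.≤-reflexive (count-none P? λ i p → ¬w (i , p))) (ℕ.<⇒≱ 0<c)

count-≤-length : ∀ {n} {P : Fin n → Set} (P? : Decidable P) l → (∀ i → P i → i ∈ l) → count P? ≤ length l
count-≤-length P? [] h = ℕ.≤-reflexive (count-none P? λ i p → contradiction (h i p) λ ())
count-≤-length {P = P} P? (x ∷ l) h =
  ℕ.≤-trans (count-≤-suc P? P∖x? x λ i p i≢x → p , i≢x)
            (s≤s (count-≤-length P∖x? l λ i (p , i≢x) → drop i≢x (h i p)))
  where
  P∖x? = λ i → P? i ×-dec ¬? (i Fin.≟ x)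
  drop : ∀ {i} → i ≢ x → i ∈ x ∷ l → i ∈ l
  drop i≢x (here eq) = contradiction eq i≢x
  drop _   (there m) = m

length-≤-count : ∀ {n} {P : Fin n → Set} (P? : Decidable P) {l} → Unique l → All P l → length l ≤ count P?
length-≤-count P? [] [] = z≤n
length-≤-count P? {x ∷ l} (x∉l ∷ u) (p ∷ ps) =
  ℕ.≤-<-trans (length-≤-count P∖x? u (All.zip (ps , All.map (λ x≢y → x≢y ∘ sym) x∉l)))
              (count-mono-< P∖x? P? (λ _ → proj₁) x (λ (_ , x≢x) → x≢x refl) p)
  where P∖x? = λ i → P? i ×-dec ¬? (i Fin.≟ x)

2≤count⇒∃ : ∀ {n} {P : Fin n → Set} (P? : Decidable P) → 2 ≤ count P? → ∃₂ λ i j → i ≢ j × P i × P j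
2≤count⇒∃ P? 2≤c with Fin.any? (λ i → Fin.any? λ j → ¬? (i Fin.≟ j) ×-dec P? i ×-dec P? j)
... | yes w = w
... | no ¬w with Fin.any? P?
...   | yes (i , p) = contradiction 2≤c (ℕ.≤⇒≯ (count-≤-length P? (i ∷ []) λ j q →
          here (sym (decidable-stable (i Fin.≟ j) λ i≢j → ¬w (i , j , i≢j , p , q)))))
...   | no ¬∃ = contradiction 2≤c (ℕ.≤⇒≯ (ℕ.≤-trans (ℕ.≤-reflexive (count-none P? λ i p → ¬∃ (i , p))) z≤n))
-- Greedy list colouring

module DegreeColouring
  {m K : ℕ} {Adj : Fin m → Fin m → Set} (Adj? : ∀ e f → Dec (Adj e f))
  (Adj-sym : ∀ {e f} → Adj e f → Adj f e) (Adj-irrefl : ∀ {e} → ¬ Adj e e)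
  (degree≤K : ∀ e → count (Adj? e) ≤ K)
  where

  open import Data.List.Membership.DecPropositional (Fin._≟_ {m}) using (_∈?_)

  Partial : Set
  Partial = Fin m → Maybe (Fin K)

  Unc : Partial → Fin m → Set
  Unc φ e = φ e ≡ nothing

  unc? : ∀ φ e → Dec (Unc φ e)
  unc? φ e = ≡-dec Fin._≟_ (φ e) nothing

  has? : ∀ (φ : Partial) e c → Dec (φ e ≡ just c)
  has? φ e c = ≡-dec Fin._≟_ (φ e) (just c)

  coloured : ∀ {φ : Partial} {e} → ¬ Unc φ e → ∃ λ c → φ e ≡ just c
  coloured {φ} {e} ¬unc with φ e
  ... | just c  = c , refl
  ... | nothing = contradiction refl ¬unc

  unc-just : ∀ {φ : Partial} {e c} → Unc φ e → φ e ≢ just c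
  unc-just unc eq with () ← trans (sym unc) eq

  Proper : Partial → Set
  Proper φ = ∀ {e f c} → Adj e f → φ e ≡ just c → φ f ≢ just c

  Free : Partial → Fin m → Fin K → Set
  Free φ e c = ∀ f → Adj e f → φ f ≢ just c

  free? : ∀ φ e c → Dec (Free φ e c)
  free? φ e c = Fin.all? λ f → Adj? e f →-dec ¬? (has? φ f c)

  ¬free⇒∃ : ∀ {φ e c} → ¬ Free φ e c → ∃ λ f → Adj e f × φ f ≡ just c
  ¬free⇒∃ {φ} {e} {c} ¬free with Fin.any? (λ f → Adj? e f ×-dec has? φ f c)
  ... | yes w = w
  ... | no ¬w = contradiction (λ f adj eq → ¬w (f , adj , eq)) ¬free

  uncNbr? : ∀ φ e f → Dec (Adj e f × Unc φ f)
  uncNbr? φ e f = Adj? e f ×-dec unc? φ f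

  hit? : ∀ φ e f c → Dec (Adj e f × φ f ≡ just c)
  hit? φ e f c = Adj? e f ×-dec has? φ f c

  uncNbrs colNbrs freeColours : Partial → Fin m → ℕ
  uncNbrs φ e = count (uncNbr? φ e)
  colNbrs φ e = count λ f → Adj? e f ×-dec ¬? (unc? φ f)
  freeColours φ e = count (free? φ e)

  Slack : Partial → Fin m → Set
  Slack φ e = uncNbrs φ e < freeColours φ e

  module _ (φ : Partial) (e : Fin m) where

    private
      hits : Fin K → ℕ
      hits c = count λ f → hit? φ e f c

      -- Exchange the order of summation: a coloured neighbour carries exactly one colour, so it is
      -- hit only once.
      hits-sum : sum hits ≤ colNbrs φ e
      hits-sum = ℕ.≤-trans (ℕ.≤-reflexive (∑-comm λ c f → indicator (hit? φ e f c)))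
                           (sum-mono inner)
        where
        inner : ∀ f → count (hit? φ e f) ≤ indicator (Adj? e f ×-dec ¬? (unc? φ f))
        inner f = bound (Adj? e f ×-dec ¬? (unc? φ f))
          where
          bound : (d : Dec (Adj e f × ¬ Unc φ f)) → count (hit? φ e f) ≤ indicator d
          bound (yes (_ , ¬unc)) = let (c₀ , eq₀) = coloured {φ} {f} ¬unc in
            count-≤-length (hit? φ e f) (c₀ ∷ []) λ c (_ , eq) →
              here (just-injective (trans (sym eq) eq₀))
          bound (no ¬hit) = ℕ.≤-reflexive (count-none (hit? φ e f)
            λ c (adj , eq) → ¬hit (adj , λ unc → unc-just {φ} unc eq))

      free⊎hit : ∀ c → 1 ≤ indicator (free? φ e c) + hits c
      free⊎hit c = bound (free? φ e c)
        where
        bound : (d : Dec (Free φ e c)) → 1 ≤ indicator d + hits c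
        bound (yes _) = s≤s z≤n
        bound (no ¬free) = let (f , w) = ¬free⇒∃ ¬free in
          length-≤-count (λ f → hit? φ e f c) ([] ∷ []) (w ∷ [])

      total : sum (λ c → indicator (free? φ e c) + hits c) ≤ freeColours φ e + colNbrs φ e
      total = ℕ.≤-trans (ℕ.≤-reflexive (∑-distrib-+ {K} _ _)) (ℕ.+-monoʳ-≤ (freeColours φ e) hits-sum)

      nbrs : count (Adj? e) ≡ uncNbrs φ e + colNbrs φ e
      nbrs = count-split (Adj? e) (unc? φ)

      slack : count (Adj? e) < freeColours φ e + colNbrs φ e → Slack φ e
      slack = ℕ.+-cancelʳ-< (colNbrs φ e) _ _ ∘ subst (_< freeColours φ e + colNbrs φ e) nbrs

      palette : K ≤ freeColours φ e + colNbrs φ e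
      palette = ℕ.≤-trans (ℕ.≤-reflexive (sym (sum-const-1 K))) (ℕ.≤-trans (sum-mono free⊎hit) total)

    -- By `palette`, every colour is free or sits on a coloured neighbour, so free colours and
    -- coloured neighbours together number at least `K`, which bounds the degree. Cancelling the
    -- coloured neighbours leaves the invariant on which all greedy steps rest.
    uncNbrs≤freeColours : uncNbrs φ e ≤ freeColours φ e
    uncNbrs≤freeColours = ℕ.+-cancelʳ-≤ (colNbrs φ e) _ _
      (subst (_≤ freeColours φ e + colNbrs φ e) nbrs (ℕ.≤-trans (degree≤K e) palette))

    degree<K⇒slack : count (Adj? e) < K → Slack φ e
    degree<K⇒slack d<K = slack (ℕ.<-≤-trans d<K palette)

    -- A colour on two neighbours is hit twice in the count, so one free colour more remains than
    -- the degree bound ensures.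
    repeated⇒slack : ∀ {f g c} → f ≢ g → Adj e f → Adj e g → φ f ≡ just c → φ g ≡ just c → Slack φ e
    repeated⇒slack {f} {g} {c} f≢g adjf adjg eqf eqg = slack (ℕ.≤-<-trans (degree≤K e)
      (ℕ.<-≤-trans (ℕ.≤-<-trans (ℕ.≤-reflexive (sym (sum-const-1 K))) (sum-mono-< free⊎hit c strict)) total))
      where
      strict : 1 < indicator (free? φ e c) + hits c
      strict = ℕ.≤-trans (length-≤-count (λ f → hit? φ e f c)
        ((f≢g ∷ []) ∷ [] ∷ []) ((adjf , eqf) ∷ (adjg , eqg) ∷ [])) (ℕ.m≤n+m _ _)

  -- Colouring a single edge

  _[_≔_] : Partial → Fin m → Fin K → Partial
  φ [ e ≔ c ] = updateAt φ e λ _ → just c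

  module _ {φ : Partial} {e : Fin m} {c : Fin K} where

    ≔-eq : (φ [ e ≔ c ]) e ≡ just c
    ≔-eq = updateAt-updates e φ

    ≔-neq : ∀ {f} → f ≢ e → (φ [ e ≔ c ]) f ≡ φ f
    ≔-neq {f} = updateAt-minimal f e φ

    ≔-just : ∀ {f d} → (φ [ e ≔ c ]) f ≡ just d → (f ≡ e × d ≡ c) ⊎ φ f ≡ just d
    ≔-just {f} eq with f Fin.≟ e
    ... | yes refl = inj₁ (refl , just-injective (trans (sym eq) ≔-eq))
    ... | no f≢e   = inj₂ (trans (sym (≔-neq f≢e)) eq)

    ≔-unc : ∀ {f} → Unc (φ [ e ≔ c ]) f → f ≢ e × Unc φ f
    ≔-unc {f} unc with f Fin.≟ e
    ... | yes refl = contradiction ≔-eq (unc-just {φ [ e ≔ c ]} unc)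
    ... | no f≢e   = f≢e , trans (sym (≔-neq f≢e)) unc

    ≔-proper : Proper φ → Free φ e c → Proper (φ [ e ≔ c ])
    ≔-proper proper free {f} {g} adj eqf eqg with ≔-just {f} eqf | ≔-just {g} eqg
    ... | inj₁ (refl , refl) | inj₁ (refl , _)    = Adj-irrefl adj
    ... | inj₁ (refl , refl) | inj₂ eqg′          = free g adj eqg′
    ... | inj₂ eqf′          | inj₁ (refl , refl) = free f (Adj-sym adj) eqf′
    ... | inj₂ eqf′          | inj₂ eqg′          = proper adj eqf′ eqg′

    ≔-uncNbrs : ∀ g → uncNbrs (φ [ e ≔ c ]) g ≤ uncNbrs φ g
    ≔-uncNbrs g = count-mono (uncNbr? (φ [ e ≔ c ]) g) (uncNbr? φ g) λ f (adj , unc) → adj , proj₂ (≔-unc {f} unc)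

    ≔-uncNbrs-< : ∀ {g} → Unc φ e → Adj g e → uncNbrs (φ [ e ≔ c ]) g < uncNbrs φ g
    ≔-uncNbrs-< {g} unc adj = count-mono-< (uncNbr? (φ [ e ≔ c ]) g) (uncNbr? φ g)
      (λ f (adj , unc) → adj , proj₂ (≔-unc {f} unc)) e
      (λ (_ , unc′) → proj₁ (≔-unc {e} unc′) refl) (adj , unc)

    ≔-free : ∀ {g d} → Free φ g d → (Adj g e → d ≢ c) → Free (φ [ e ≔ c ]) g d
    ≔-free free d≢c f adj eq with ≔-just {f} eq
    ... | inj₁ (refl , d≡c) = d≢c adj d≡c
    ... | inj₂ eq′          = free f adj eq′

    -- A neighbour of `e` loses one uncoloured neighbour and at most one free colour; any other edge
    -- loses no free colour. The strict inequality survives in both cases.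
    ≔-slack : ∀ {g} → Unc φ e → Slack φ g → Slack (φ [ e ≔ c ]) g
    ≔-slack {g} unc slack with Adj? g e
    ... | yes adj = ℕ.s≤s⁻¹ (ℕ.<-≤-trans (ℕ.≤-<-trans (≔-uncNbrs-< unc adj) slack)
      (count-≤-suc (free? φ g) (free? (φ [ e ≔ c ]) g) c λ d free d≢c → ≔-free free λ _ → d≢c))
    ... | no ¬adj = ℕ.<-≤-trans (ℕ.≤-<-trans (≔-uncNbrs g) slack)
      (count-mono (free? φ g) (free? (φ [ e ≔ c ]) g) λ d free → ≔-free free λ adj → contradiction adj ¬adj)

    -- An uncoloured neighbour of `g` disappears, but no free colour does, as `c` was already
    -- blocked there. The weak inequality at `g` becomes strict.
    ≔-gain-slack : ∀ {g} → Unc φ e → Adj g e → ¬ Free φ g c → Slack (φ [ e ≔ c ]) g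
    ≔-gain-slack {g} unc adj ¬free = ℕ.<-≤-trans (≔-uncNbrs-< unc adj) (ℕ.≤-trans (uncNbrs≤freeColours φ g)
      (count-mono (free? φ g) (free? (φ [ e ≔ c ]) g) λ d free → ≔-free free λ _ d≡c → ¬free (subst (Free φ g) d≡c free)))

  slack⇒free : ∀ {φ e} → Slack φ e → ∃ (Free φ e)
  slack⇒free {φ} {e} slack = 0<count⇒∃ (free? φ e) (ℕ.≤-<-trans z≤n slack)

  uncNbr⇒free : ∀ {φ e f} → Adj e f → Unc φ f → ∃ (Free φ e)
  uncNbr⇒free {φ} {e} adj unc = 0<count⇒∃ (free? φ e)
    (ℕ.<-≤-trans (length-≤-count (uncNbr? φ e) ([] ∷ []) ((adj , unc) ∷ []))
                 (uncNbrs≤freeColours φ e))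

  -- Completions and the order of colouring

  record Completion (φ : Partial) (l : List (Fin m)) : Set where
    field
      colouring : Partial
      proper    : Proper colouring
      on        : ∀ {e} → e ∈ l → ¬ Unc colouring e
      off       : ∀ {e} → e ∉ l → colouring e ≡ φ e

    on⇒∉ : ∀ {e} → Unc colouring e → e ∉ l
    on⇒∉ unc e∈l = on e∈l unc

    unc⇒unc : ∀ {e} → Unc colouring e → Unc φ e
    unc⇒unc unc = trans (sym (off (on⇒∉ unc))) unc

  open Completion

  Completion-cons : ∀ {φ e c l} → Completion (φ [ e ≔ c ]) l → e ∉ l → Completion φ (e ∷ l)
  Completion-cons {φ} {e} {c} C e∉l = record
    { colouring = colouring C
    ; proper    = proper C
    ; on        = λ { (here refl) unc → unc-just {colouring C} unc (trans (off C e∉l) (≔-eq {φ}))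
                    ; (there f∈l) → on C f∈l }
    ; off       = λ f∉ → trans (off C (f∉ ∘ there)) (≔-neq {φ} (f∉ ∘ here))
    }

  Completion-++ : ∀ {φ l w} (C : Completion φ l) → Completion (colouring C) w →
                  (∀ {e} → e ∈ l → e ∉ w) → Completion φ (l ++ w)
  Completion-++ {φ} {l} C D l∩w=∅ = record
    { colouring = colouring D
    ; proper    = proper D
    ; on        = λ e∈ unc → Sum.[ (λ e∈l → on C e∈l (unc⇒unc D unc)) , (λ e∈w → on D e∈w unc) ]′ (∈-++⁻ l e∈)
    ; off       = λ e∉ → trans (off D (e∉ ∘ ∈-++⁺ʳ l)) (off C (e∉ ∘ ∈-++⁺ˡ))
    }

  -- The head is coloured first. At its turn, an edge without `B` still has an uncoloured neighbour
  -- further down the list, so the list is ordered towards the edges with `B`.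
  data Run (B : Fin m → Set) : List (Fin m) → Set where
    []  : Run B []
    _∷_ : ∀ {e l} → B e ⊎ (∃ λ f → f ∈ l × Adj e f) → Run B l → Run B (e ∷ l)

  Run-map : ∀ {B B′ l} → (∀ {e} → B e → B′ e) → Run B l → Run B′ l
  Run-map f []      = []
  Run-map f (r ∷ R) = Sum.map₁ f r ∷ Run-map f R

  -- The edges of `w` stay uncoloured throughout the run, so an edge adjacent to one of them never
  -- runs out of uncoloured neighbours.
  Anchored : List (Fin m) → Partial → Fin m → Set
  Anchored w φ e = Slack φ e ⊎ ∃ λ f → f ∈ w × Adj e f

  -- A free colour exists at each turn: for a slack edge by strictness, for any other because an
  -- uncoloured neighbour is left and free colours are at least as many. Slack further down survives
  -- by `≔-slack`.
  complete-run : ∀ {φ w l} → Proper φ → All (Unc φ) w → All (Unc φ) l → Unique l →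
                 (∀ {e} → e ∈ l → e ∉ w) → Run (Anchored w φ) l → Completion φ l
  complete-run {φ} proper _ _ _ _ [] =
    record { colouring = φ ; proper = proper ; on = λ () ; off = λ _ → refl }
  complete-run {φ} {w} {e ∷ l} proper uw (ue ∷ ul) (e# ∷ unique) l∩w=∅ (r ∷ R) =
    Completion-cons
      (complete-run (≔-proper proper free)
        (All.tabulate λ f∈w → trans (≔-neq {φ} λ { refl → l∩w=∅ (here refl) f∈w }) (All.lookup uw f∈w))
        (All.tabulate λ f∈l → trans (≔-neq {φ} λ { refl → e∉l f∈l }) (All.lookup ul f∈l))
        unique (l∩w=∅ ∘ there) (Run-map (Sum.map₁ (≔-slack ue)) R))
      e∉l
    where
    e∉l : e ∉ l
    e∉l = All¬⇒¬Any e#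
    available : ∃ (Free φ e)
    available = Sum.[ Sum.[ slack⇒free , (λ (f , f∈w , adj) → uncNbr⇒free adj (All.lookup uw f∈w)) ]′
                    , (λ (f , f∈l , adj) → uncNbr⇒free adj (All.lookup ul f∈l)) ]′ r
    c = proj₁ available
    free = proj₂ available

  -- For a list of uncoloured edges this means a union of components of the uncoloured part. After
  -- such a list is coloured, no newly coloured edge meets a remaining uncoloured one.
  Closed : Partial → List (Fin m) → Set
  Closed φ X = ∀ {e f} → e ∈ X → Adj e f → Unc φ f → f ∈ X

  record Growth (φ : Partial) (B : Fin m → Set) (w l₀ : List (Fin m)) : Set where
    field
      l      : List (Fin m)
      l₀⊆l   : ∀ {e} → e ∈ l₀ → e ∈ l
      unc    : All (Unc φ) l
      unique : Unique l
      apart  : ∀ {e} → e ∈ l → e ∉ w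
      run    : Run B l
      closed : Closed φ (l ++ w)

  -- Uncoloured neighbours are put at the head until none is left outside `l ++ w`; each is adjacent
  -- to the run behind it or to `w`. The number of edges outside decreases each time.
  grow : ∀ φ {B} w {l} → (∀ {e f} → f ∈ w → Adj e f → B e) → All (Unc φ) l → Unique l →
         (∀ {e} → e ∈ l → e ∉ w) → Run B l → Growth φ B w l
  grow φ {B} w B-adj ul unique apart run =
    go _ ul unique apart run (ℕ.n<1+n _)
    where
    outside? : ∀ l f → Dec (f ∉ l ++ w)
    outside? l f = ¬? (f ∈? l ++ w)

    go : ∀ N {l} → All (Unc φ) l → Unique l → (∀ {e} → e ∈ l → e ∉ w) → Run B l →
         count (outside? l) < N → Growth φ B w l
    go (suc N) {l} ul unique apart run bound
      with Fin.any? (λ e → e ∈? l ++ w ×-dec Fin.any? λ f → Adj? e f ×-dec unc? φ f ×-dec outside? l f)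
    ... | no ¬exit = record
      { l = l ; l₀⊆l = id ; unc = ul ; unique = unique ; apart = apart ; run = run
      ; closed = λ {e} {f} e∈ adj unc → decidable-stable (f ∈? l ++ w) λ f∉ → ¬exit (e , e∈ , f , adj , unc , f∉) }
    ... | yes (e , e∈ , f , adj , unc , f∉) = record { Growth G hiding (l₀⊆l) ; l₀⊆l = Growth.l₀⊆l G ∘ there }
      where
      link : B f ⊎ ∃ λ e → e ∈ l × Adj f e
      link with ∈-++⁻ l e∈
      ... | inj₁ e∈l = inj₂ (e , e∈l , Adj-sym adj)
      ... | inj₂ e∈w = inj₁ (B-adj e∈w (Adj-sym adj))
      G = go N (unc ∷ ul) (¬Any⇒All¬ l (f∉ ∘ ∈-++⁺ˡ) ∷ unique)
             (λ { (here refl) f∈w → f∉ (∈-++⁺ʳ l f∈w) ; (there g∈l) → apart g∈l }) (link ∷ run)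
             (ℕ.<-≤-trans (count-mono-< (outside? (f ∷ l)) (outside? l) (λ g g∉ → g∉ ∘ there) f
               (λ f∉′ → f∉′ (here refl)) f∉) (ℕ.s≤s⁻¹ bound))

  -- `start` makes the closed set nonempty, so that the completion leaves strictly fewer uncoloured
  -- edges.
  record Progress (φ : Partial) : Set where
    field
      X          : List (Fin m)
      unc        : All (Unc φ) X
      start      : Fin m
      start∈X    : start ∈ X
      closed     : Closed φ X
      completion : Completion φ X

  grow-closed : ∀ {φ B l} (G : Growth φ B [] l) → Closed φ (Growth.l G)
  grow-closed {φ} G = subst (Closed φ) (++-identityʳ _) (Growth.closed G)

  run-progress : ∀ {φ e q} → Proper φ → All (Unc φ) q → Unique q → e ∈ q → Run (Slack φ) q → Progress φ
  run-progress {φ} {e} proper uq unique e∈q run = record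
    { X = G.l
    ; unc = G.unc
    ; start = e
    ; start∈X = G.l₀⊆l e∈q
    ; closed = grow-closed growth
    ; completion = complete-run proper [] G.unc G.unique (λ _ ()) (Run-map inj₁ G.run)
    }
    where
    growth = grow φ [] (λ ()) uq unique (λ _ ()) run
    module G = Growth growth

  slack-progress : ∀ {φ e} → Proper φ → Unc φ e → Slack φ e → Progress φ
  slack-progress proper unc slack = run-progress proper (unc ∷ []) ([] ∷ []) (here refl) (inj₁ slack ∷ [])

  -- Colouring e with a colour that is not available at f makes f slack.
  lists-differ-progress : ∀ {φ e f c q} → Proper φ → Unc φ e → All (Unc φ) q → Unique q → e ∉ q → f ∈ q →
    Run (_≡ f) q → Adj e f → (∀ {g} → Unc φ g → Adj e g → g ∈ q ⊎ ∃ λ h → h ∈ q × Adj g h) →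
    Free φ e c → ¬ Free φ f c → Progress φ
  lists-differ-progress {φ} {e} {f} {c} {q} proper ue uq unique e∉q f∈q run adj nbrs free ¬free = record
    { X = e ∷ G.l
    ; unc = ue ∷ All.map (λ {g} u → proj₂ (≔-unc {f = g} u)) G.unc
    ; start = e
    ; start∈X = here refl
    ; closed = closed
    ; completion = Completion-cons
        (complete-run (≔-proper proper free) [] G.unc G.unique (λ _ ()) (Run-map inj₁ G.run))
        λ e∈l → proj₁ (≔-unc {f = e} (All.lookup G.unc e∈l)) refl
    }
    where
    φ′ = φ [ e ≔ c ]
    unc′ : ∀ {g} → g ≢ e → Unc φ g → Unc φ′ g
    unc′ g≢e = trans (≔-neq g≢e)
    growth = grow φ′ [] (λ ()) (All.tabulate λ g∈q → unc′ (λ { refl → e∉q g∈q }) (All.lookup uq g∈q))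
      unique (λ _ ()) (Run-map {B′ = Slack φ′} (λ { refl → ≔-gain-slack ue (Adj-sym adj) ¬free }) run)
    module G = Growth growth
    closed : Closed φ (e ∷ G.l)
    closed {_} {g} h∈ adj ug with g Fin.≟ e
    ... | yes refl = here refl
    ... | no g≢e with h∈
    ...   | there h∈l = there (grow-closed growth h∈l adj (unc′ g≢e ug))
    -- An uncoloured neighbour of `e` is in `q` or adjacent to it, hence absorbed by the growth of
    -- `q`.
    ...   | here refl with nbrs ug adj
    ...     | inj₁ g∈q              = there (G.l₀⊆l g∈q)
    ...     | inj₂ (h , h∈q , adj′) = there (grow-closed growth (G.l₀⊆l h∈q) (Adj-sym adj′) (unc′ g≢e ug))

  -- If `f` is slack, colour towards it. Otherwise `f` has no more free colours than uncoloured
  -- neighbours, hence fewer free colours than `e`. Some colour is then free at `e` only, and giving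
  -- it to `e` makes `f` slack.
  complete-core : ∀ {φ e f q} → Proper φ → All (Unc φ) (e ∷ q) → Unique (e ∷ q) → f ∈ q → Run (_≡ f) q →
                  Adj e f → uncNbrs φ f < uncNbrs φ e → Completion φ (e ∷ q)
  complete-core {φ} {e} {f} {q} proper u@(ue ∷ uq) unique@(e# ∷ unique-q) f∈q run adj f<e
    with uncNbrs φ f <? freeColours φ f
  ... | yes slack = complete-run proper [] u unique (λ _ ()) (inj₂ (f , f∈q , adj) ∷ Run-map (λ { refl → inj₁ slack }) run)
  ... | no tight =
    let (c , free , ¬free) = count-<⇒∃ (free? φ f) (free? φ e)
          (ℕ.≤-<-trans (ℕ.≮⇒≥ tight) (ℕ.<-≤-trans f<e (uncNbrs≤freeColours φ e)))
    in Completion-cons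
         (complete-run (≔-proper proper free) []
           (All.tabulate λ g∈q → trans (≔-neq λ { refl → e∉q g∈q }) (All.lookup uq g∈q)) unique-q (λ _ ())
           (Run-map (λ { refl → inj₁ (≔-gain-slack ue (Adj-sym adj) ¬free) }) run))
         e∉q
    where
    e∉q : e ∉ q
    e∉q = All¬⇒¬Any e#

  -- First colour everything else towards e ∷ q; then the uncoloured neighbours
  -- of e and f all lie in e ∷ q, and e has more of them than f.
  core-progress : ∀ {φ e f q ne nf} → Proper φ → All (Unc φ) (e ∷ q) → Unique (e ∷ q) → f ∈ q → Run (_≡ f) q → Adj e f →
    Unique ne → All (λ g → g ∈ q × Adj e g) ne → (∀ {g} → g ∈ e ∷ q → Adj f g → g ∈ nf) → length nf < length ne →
    Progress φ
  core-progress {φ} {e} {f} {q} {ne} {nf} proper u@(ue ∷ uq) unique f∈q run adj unique-ne in-ne in-nf nf<ne = record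
    { X = G.l ++ w
    ; unc = ++⁺ G.unc u
    ; start = e
    ; start∈X = ∈-++⁺ʳ G.l (here refl)
    ; closed = G.closed
    ; completion = Completion-++ C (complete-core C.proper (All.tabulate unc-w) unique f∈q run adj f<e) G.apart
    }
    where
    w = e ∷ q
    module G = Growth (grow φ {λ e → ∃ λ f → f ∈ w × Adj e f} w (λ f∈w adj → _ , f∈w , adj) [] [] (λ ()) [])
    C = complete-run proper u G.unc G.unique G.apart (Run-map inj₂ G.run)
    module C = Completion C
    ψ = C.colouring
    unc-w : ∀ {g} → g ∈ w → Unc ψ g
    unc-w g∈w = trans (C.off λ g∈l → G.apart g∈l g∈w) (All.lookup u g∈w)
    f<e : uncNbrs ψ f < uncNbrs ψ e
    f<e = ℕ.≤-<-trans (count-≤-length (uncNbr? ψ f) nf nbr∈nf) (ℕ.<-≤-trans nf<ne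
      (length-≤-count (uncNbr? ψ e) unique-ne (All.map (λ (g∈q , adj) → adj , unc-w (there g∈q)) in-ne)))
      where
      nbr∈nf : ∀ g → Adj f g × Unc ψ g → g ∈ nf
      nbr∈nf g (adj , ug) with ∈-++⁻ G.l (G.closed (∈-++⁺ʳ G.l (there f∈q)) adj (C.unc⇒unc ug))
      ... | inj₁ g∈l = contradiction g∈l (C.on⇒∉ ug)
      ... | inj₂ g∈w = in-nf g∈w adj

-- Exhaustive search over functions between finite sets

anyFunction? : ∀ {m K} {Q : (Fin m → Fin K) → Set} → (∀ {f g} → f ≗ g → Q f → Q g) → (∀ f → Dec (Q f)) → Dec (∃ Q)
anyFunction? {zero}  respects Q? = map′ (λ q → _ , q) (λ (_ , q) → respects (λ ()) q) (Q? λ ())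
anyFunction? {suc m} respects Q? = map′
  (λ (a , f , q) → a ∷ᶠ f , q)
  -- Head and tail reassemble to a function that is only pointwise equal to `f`, hence the need for
  -- `respects`.
  (λ (f , q) → f zero , f ∘ suc , respects (λ { zero → refl ; (suc _) → refl }) q)
  (Fin.any? λ a → anyFunction? (λ f≗g → respects λ { zero → refl ; (suc i) → f≗g i }) λ f → Q? (a ∷ᶠ f))

-- Closed walks

record FirstRepeat {n} (v : ℕ → Fin n) : Set where
  field
    start period : ℕ
    0<period : 0 < period
    repeat   : v (period + start) ≡ v start
    injective-below : ∀ {i j} → i < j → j < period + start → v i ≢ v j

-- The search proceeds upwards, so the first repeat it meets has no earlier one. By the pigeonhole
-- principle it cannot pass `suc n` entries without a repeat.
firstRepeat : ∀ {n} (v : ℕ → Fin n) → FirstRepeat v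
firstRepeat {n} v with search (suc n)
  where
  InjectiveBelow : ℕ → Set
  InjectiveBelow b = ∀ {i j} → i < j → j < b → v i ≢ v j

  search : ∀ b → InjectiveBelow b ⊎ FirstRepeat v
  search zero = inj₁ λ _ ()
  search (suc b) with search b
  ... | inj₂ found = inj₂ found
  ... | inj₁ inj with ℕ.anyUpTo? (λ i → v i Fin.≟ v b) b
  ...   | yes (i , i<b , eq) = inj₂ (record
            { start = i ; period = b ∸ i ; 0<period = ℕ.m<n⇒0<n∸m i<b
            ; repeat = trans (cong v b≡) (sym eq)
            ; injective-below = λ i<j j<b → inj i<j (subst (_ <_) b≡ j<b) })
    where b≡ = ℕ.m∸n+n≡m (ℕ.<⇒≤ i<b)
  ...   | no ¬any = inj₁ extended
    where
    extended : InjectiveBelow (suc b)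
    extended {i} {j} i<j j<1+b eq with j ℕ.≟ b
    ... | yes refl = ¬any (i , i<j , eq)
    ... | no j≢b   = inj i<j (ℕ.≤∧≢⇒< (ℕ.s≤s⁻¹ j<1+b) j≢b) eq
... | inj₂ found = found
... | inj₁ inj =
  let (i , j , i<j , eq) = Fin.pigeonhole (ℕ.n<1+n n) (v ∘ toℕ)
  in contradiction eq (inj i<j (Fin.toℕ<n j))

module Wrap (p : ℕ) where

  -- wrap i is the residue of i modulo suc p.
  next : ℕ → ℕ
  next x with suc x ℕ.≟ suc p
  ... | yes _ = 0
  ... | no  _ = suc x

  wrap : ℕ → ℕ
  wrap zero    = 0
  wrap (suc i) = next (wrap i)

  next-< : ∀ {x} → x < suc p → next x < suc p
  next-< {x} x<p with suc x ℕ.≟ suc p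
  ... | yes _ = z<s
  ... | no ≢  = ℕ.≤∧≢⇒< x<p ≢

  wrap-< : ∀ i → wrap i < suc p
  wrap-< zero    = z<s
  wrap-< (suc i) = next-< (wrap-< i)

  -- A shift by at most one period passes the modulus at most once. Adding `suc p` on the left
  -- avoids subtraction.
  wrap-+ : ∀ i d → d ≤ suc p → (wrap (d + i) ≡ d + wrap i) ⊎ (suc p + wrap (d + i) ≡ d + wrap i)
  wrap-+ i zero    _   = inj₁ refl
  wrap-+ i (suc d) d<p with wrap-+ i d (ℕ.<⇒≤ d<p) | suc (wrap (d + i)) ℕ.≟ suc p
  ... | inj₁ eq | yes eq′ = inj₂ (trans (ℕ.+-identityʳ (suc p)) (trans (sym eq′) (cong suc eq)))
  ... | inj₁ eq | no _    = inj₁ (cong suc eq)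
  ... | inj₂ eq | yes eq′ = contradiction
          (trans (cong (suc p +_) (sym eq′)) (trans (ℕ.+-suc (suc p) _) (cong suc eq)))
          (ℕ.>⇒≢ (ℕ.+-mono-≤-< d<p (wrap-< i)))
  ... | inj₂ eq | no _    = inj₂ (trans (ℕ.+-suc (suc p) _) (cong suc eq))

  wrap-period : ∀ i → wrap (suc p + i) ≡ wrap i
  wrap-period i with wrap-+ i (suc p) ℕ.≤-refl
  ... | inj₁ eq = contradiction (subst (_< suc p) eq (wrap-< (suc p + i))) (ℕ.m+n≮m (suc p) (wrap i))
  ... | inj₂ eq = ℕ.+-cancelˡ-≡ (suc p) _ _ eq

  wrap-distinct : ∀ i {d} → 0 < d → d < suc p → wrap (d + i) ≢ wrap i
  wrap-distinct i {d} 0<d d<p eq with wrap-+ i d (ℕ.<⇒≤ d<p)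
  ... | inj₁ eq′ = ℕ.<⇒≢ (ℕ.m<n+m (wrap i) 0<d) (trans (sym eq) eq′)
  ... | inj₂ eq′ = ℕ.<⇒≢ d<p (sym (ℕ.+-cancelʳ-≡ (wrap i) (suc p) d (trans (cong (suc p +_) (sym eq)) eq′)))

-- Every window of one full period takes all values. The base of the window is moved from `j` down
-- to 0 and up to `i` in single steps, with the offset adjusted each time.
periodic-cover : ∀ {A : Set} {p} {f : ℕ → A} → (∀ i → f (suc p + i) ≡ f i) →
                 ∀ i j → ∃ λ s → s < suc p × f j ≡ f (s + i)
periodic-cover {p = p} {f} period i j = up i (down j (0 , z<s , refl))
  where
  Covered : ℕ → Set
  Covered i = ∃ λ s → s < suc p × f j ≡ f (s + i)

  up₁ : ∀ i → Covered i → Covered (suc i)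
  up₁ i (zero  , _   , eq) = p , ℕ.≤-refl , trans eq (trans (sym (period i)) (cong f (sym (ℕ.+-suc p i))))
  up₁ i (suc s , s<p , eq) = s , ℕ.<⇒≤ s<p , trans eq (cong f (sym (ℕ.+-suc s i)))

  down₁ : ∀ i → Covered (suc i) → Covered i
  down₁ i (s , s<p , eq) with s ℕ.≟ p
  ... | yes refl = 0 , z<s , trans eq (trans (cong f (ℕ.+-suc p i)) (period i))
  ... | no s≢p   = suc s , s<s (ℕ.≤∧≢⇒< (ℕ.s≤s⁻¹ s<p) s≢p) , trans eq (cong f (ℕ.+-suc s i))

  up : ∀ i → Covered 0 → Covered i
  up zero    c = c
  up (suc i) c = up₁ i (up i c)

  down : ∀ i → Covered i → Covered 0
  down zero    c = c
  down (suc i) c = down i (down₁ i c)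

-- Multigraphs

module GraphFacts (G : Multigraph) where
  open Multigraph G

  Joins : Fin m → Fin n → Fin n → Set
  Joins e u v = (ends e ≡ (u , v)) ⊎ (ends e ≡ (v , u))

  Joins-sym : ∀ {e u v} → Joins e u v → Joins e v u
  Joins-sym = Sum.swap

  Joins⇒Incˡ : ∀ {e u v} → Joins e u v → Inc G e u
  Joins⇒Incˡ (inj₁ eq) = inj₁ (cong proj₁ eq)
  Joins⇒Incˡ (inj₂ eq) = inj₂ (cong proj₂ eq)

  Joins⇒Incʳ : ∀ {e u v} → Joins e u v → Inc G e v
  Joins⇒Incʳ = Joins⇒Incˡ ∘ Joins-sym

  Joins⇒≢ : ∀ {e u v} → Joins e u v → u ≢ v
  Joins⇒≢ {e} (inj₁ eq) u≡v = loopless e (trans (cong proj₁ eq) (trans u≡v (sym (cong proj₂ eq))))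
  Joins⇒≢ {e} (inj₂ eq) u≡v = loopless e (trans (cong proj₁ eq) (trans (sym u≡v) (sym (cong proj₂ eq))))

  Joins-ends : ∀ {e u v x} → Joins e u v → Inc G e x → x ≡ u ⊎ x ≡ v
  Joins-ends (inj₁ eq) (inj₁ i) = inj₁ (trans (sym i) (cong proj₁ eq))
  Joins-ends (inj₁ eq) (inj₂ i) = inj₂ (trans (sym i) (cong proj₂ eq))
  Joins-ends (inj₂ eq) (inj₁ i) = inj₂ (trans (sym i) (cong proj₁ eq))
  Joins-ends (inj₂ eq) (inj₂ i) = inj₁ (trans (sym i) (cong proj₂ eq))

  Inc⇒Joins : ∀ {e u} → Inc G e u → ∃ λ v → Joins e u v
  Inc⇒Joins {e} (inj₁ eq) = proj₂ (ends e) , inj₁ (cong (_, proj₂ (ends e)) eq)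
  Inc⇒Joins {e} (inj₂ eq) = proj₁ (ends e) , inj₂ (cong (proj₁ (ends e) ,_) eq)

  Inc₂⇒Joins : ∀ {e u v} → u ≢ v → Inc G e u → Inc G e v → Joins e u v
  Inc₂⇒Joins u≢v iu iv with Inc⇒Joins iu
  ... | w , j with Joins-ends j iv
  ...   | inj₁ v≡u  = contradiction (sym v≡u) u≢v
  ...   | inj₂ refl = j

  inc? : ∀ e v → Dec (Inc G e v)
  inc? e v = (proj₁ (ends e) Fin.≟ v) ⊎-dec (proj₂ (ends e) Fin.≟ v)

  inc₂? : ∀ u v e → Dec (Inc G e u × Inc G e v)
  inc₂? u v e = inc? e u ×-dec inc? e v

  adjL? : ∀ e f → Dec (AdjL G e f)
  adjL? e f = map′
    (λ (e≢f , i) → e≢f , Sum.[ (λ i → _ , inj₁ refl , i) , (λ i → _ , inj₂ refl , i) ]′ i)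
    (λ (e≢f , v , i , j) → e≢f , Sum.map (λ { refl → j }) (λ { refl → j }) i)
    (¬? (e Fin.≟ f) ×-dec (inc? f (proj₁ (ends e)) ⊎-dec inc? f (proj₂ (ends e))))

  adjL-sym : ∀ {e f} → AdjL G e f → AdjL G f e
  adjL-sym (e≢f , v , i , j) = e≢f ∘ sym , v , j , i

  adjL-irrefl : ∀ {e} → ¬ AdjL G e e
  adjL-irrefl (e≢e , _) = e≢e refl

  countE≡count : ∀ p {P : Fin m → Set} (P? : Decidable P) → (∀ e → p e ≡ does (P? e)) → countE G p ≡ count P?
  countE≡count p P? p≡ = trans (filter-tabulate id) (sum-cong-≗ λ e → cong (if_then 1 else 0) (p≡ e))
    where
    filter-tabulate : ∀ {k} (f : Fin k → Fin m) →
      length (filterᵇ p (tabulate f)) ≡ sum λ i → if p (f i) then 1 else 0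
    filter-tabulate {zero}  f = refl
    filter-tabulate {suc k} f with p (f zero)
    ... | true  = cong suc (filter-tabulate (f ∘ suc))
    ... | false = filter-tabulate (f ∘ suc)

  incᵇ≡ : ∀ e v → incᵇ G e v ≡ does (inc? e v)
  incᵇ≡ e v = cong₂ _∨_ (isYes≗does (proj₁ (ends e) Fin.≟ v)) (isYes≗does (proj₂ (ends e) Fin.≟ v))

  degree≡ : ∀ v → degree G v ≡ count (λ e → inc? e v)
  degree≡ v = countE≡count _ (λ e → inc? e v) λ e → incᵇ≡ e v

  mult≡ : ∀ u v → mult G u v ≡ count (inc₂? u v)
  mult≡ u v = countE≡count _ (inc₂? u v) λ e → cong₂ _∧_ (incᵇ≡ e u) (incᵇ≡ e v)

  mult-sym : ∀ u v → mult G u v ≡ mult G v u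
  mult-sym u v = trans (mult≡ u v) (trans
    (ℕ.≤-antisym (count-mono (inc₂? u v) (inc₂? v u) λ _ → swap) (count-mono (inc₂? v u) (inc₂? u v) λ _ → swap))
    (sym (mult≡ v u)))

  degreeL≡ : ∀ e → degreeL G e ≡ count (adjL? e)
  degreeL≡ e = countE≡count _ (adjL? e) λ f → cong₂ _∧_ (cong not (isYes≗does (e Fin.≟ f)))
    (cong₂ _∨_ (incᵇ≡ f (proj₁ (ends e))) (incᵇ≡ f (proj₂ (ends e))))

  -- Count edge by edge: an edge meeting `u` or `v` is `e` or a neighbour of `e`, and it counts once
  -- more on both sides if it meets both. The `suc` stands for `e` itself.
  degreeL-formula : ∀ {e u v} → Joins e u v → suc (degreeL G e + mult G u v) ≡ degree G u + degree G v
  degreeL-formula {e} {u} {v} j = begin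
    suc (degreeL G e + mult G u v)
      ≡⟨ cong₂ _+_ (sym (count-≡ e)) (cong₂ _+_ (degreeL≡ e) (mult≡ u v)) ⟩
    count (Fin._≟ e) + (count (adjL? e) + count (inc₂? u v))
      ≡⟨ cong (count (Fin._≟ e) +_) (∑-distrib-+ (indicator ∘ adjL? e) (indicator ∘ inc₂? u v)) ⟨
    count (Fin._≟ e) + sum (λ f → indicator (adjL? e f) + indicator (inc₂? u v f))
      ≡⟨ ∑-distrib-+ (indicator ∘ (Fin._≟ e)) (λ f → indicator (adjL? e f) + indicator (inc₂? u v f)) ⟨
    sum (λ f → indicator (f Fin.≟ e) + (indicator (adjL? e f) + indicator (inc₂? u v f)))
      ≡⟨ sum-cong-≗ (λ f → pointwise f (f Fin.≟ e) (adjL? e f) (inc? f u) (inc? f v)) ⟩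
    sum (λ f → indicator (inc? f u) + indicator (inc? f v))
      ≡⟨ ∑-distrib-+ (λ f → indicator (inc? f u)) (λ f → indicator (inc? f v)) ⟩
    count (λ f → inc? f u) + count (λ f → inc? f v)
      ≡⟨ cong₂ _+_ (degree≡ u) (degree≡ v) ⟨
    degree G u + degree G v ∎
    where
    open ≡-Reasoning
    pointwise : ∀ f (f≟e : Dec (f ≡ e)) (adj : Dec (AdjL G e f)) (iu : Dec (Inc G f u)) (iv : Dec (Inc G f v)) →
      indicator f≟e + (indicator adj + indicator (iu ×-dec iv)) ≡ indicator iu + indicator iv
    pointwise f (yes refl) (yes adj) _ _ = contradiction adj adjL-irrefl
    pointwise f (yes refl) (no _) (yes _) (yes _) = refl
    pointwise f (yes refl) (no _) (no ¬iu) _ = contradiction (Joins⇒Incˡ j) ¬iu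
    pointwise f (yes refl) (no _) (yes _) (no ¬iv) = contradiction (Joins⇒Incʳ j) ¬iv
    pointwise f (no _) (yes _) (yes _) (yes _) = refl
    pointwise f (no _) (yes _) (yes _) (no _) = refl
    pointwise f (no _) (yes _) (no _) (yes _) = refl
    pointwise f (no _) (yes (_ , x , ex , fx)) (no ¬iu) (no ¬iv) with Joins-ends j ex
    ... | inj₁ refl = contradiction fx ¬iu
    ... | inj₂ refl = contradiction fx ¬iv
    pointwise f (no f≢e) (no ¬adj) (yes iu) _ = contradiction (f≢e ∘ sym , u , Joins⇒Incˡ j , iu) ¬adj
    pointwise f (no f≢e) (no ¬adj) (no _) (yes iv) = contradiction (f≢e ∘ sym , v , Joins⇒Incʳ j , iv) ¬adj
    pointwise f (no _) (no _) (no _) (no _) = refl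

  foldr-⊔-upper : ∀ {k} (f : Fin k → ℕ) i → f i ≤ foldr _⊔_ 0 (map f (allFin k))
  foldr-⊔-upper f i = upper (∈-map⁺ f (∈-allFin i))
    where
    upper : ∀ {x xs} → x ∈ xs → x ≤ foldr _⊔_ 0 xs
    upper (here refl) = ℕ.m≤m⊔n _ _
    upper (there x∈)  = ℕ.m≤n⇒m≤o⊔n _ (upper x∈)

  degree≤Δ : ∀ v → degree G v ≤ Δ G
  degree≤Δ = foldr-⊔-upper (degree G)

  Δ-attained : Fin n → ∃ λ v → degree G v ≡ Δ G
  Δ-attained v with foldr-selective ℕ.⊔-sel 0 (map (degree G) (allFin n))
  ... | inj₁ Δ≡0 = v , ℕ.≤-antisym (degree≤Δ v) (subst (_≤ degree G v) (sym Δ≡0) z≤n)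
  ... | inj₂ Δ∈  = let (u , _ , eq) = ∈-map⁻ (degree G) Δ∈ in u , sym eq

  degreeL≤ΔL : ∀ e → degreeL G e ≤ ΔL G
  degreeL≤ΔL = foldr-⊔-upper (degreeL G)

  -- The cycle is unrolled to sequences of period `3 + r` over all natural numbers, so that indices
  -- need no reduction; `distinct` compares positions less than a period apart.
  record Cycle (Unc : Fin m → Set) : Set where
    field
      r         : ℕ
      v         : ℕ → Fin n
      ed        : ℕ → Fin m
      v-period  : ∀ i → v (3 + r + i) ≡ v i
      ed-period : ∀ i → ed (3 + r + i) ≡ ed i
      joins     : ∀ i → Joins (ed i) (v i) (v (suc i))
      distinct  : ∀ i {d} → 0 < d → d < 3 + r → v (d + i) ≢ v i
      unc       : ∀ i → Unc (ed i)

  module _ {Unc : Fin m → Set}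
    (continue : ∀ {e u v} → Unc e → Joins e u v → ∃₂ λ f w → Unc f × Joins f v w × w ≢ u) where

    private
      record Dart : Set where
        constructor dart
        field
          {edge} : Fin m
          {src tgt} : Fin n
          unc : Unc edge
          joins : Joins edge src tgt
      open Dart

      advance : Dart → Dart
      advance d = let (_ , _ , unc , joins , _) = continue (d .unc) (d .joins) in dart unc joins

    -- Walk on without turning back until a vertex repeats. Period 1 contradicts the absence of
    -- loops and period 2 the choice made by `continue`, so the closed segment has length at least
    -- 3.
    exists-cycle : ∀ {e} → Unc e → Cycle Unc
    exists-cycle {e} ue = from-period FR.period FR.repeat FR.0<period FR.injective-below
      where
      walk : ℕ → Dart
      walk zero    = dart ue (inj₁ refl)
      walk (suc i) = advance (walk i)
      x : ℕ → Fin n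
      x i = src (walk i)
      no-return : ∀ i → x (2 + i) ≢ x i
      no-return i = let (_ , _ , _ , _ , ≢) = continue (walk i .unc) (walk i .joins) in ≢
      module FR = FirstRepeat (firstRepeat x)

      from-period : ∀ p → x (p + FR.start) ≡ x FR.start → 0 < p →
                    (∀ {i j} → i < j → j < p + FR.start → x i ≢ x j) → Cycle Unc
      from-period 1 eq _ _ = contradiction (sym eq) (Joins⇒≢ (walk FR.start .joins))
      from-period 2 eq _ _ = contradiction eq (no-return FR.start)
      from-period (suc (suc (suc r))) eq _ inj = record
        { r = r
        -- The segment between the two visits is repeated periodically by `wrap`.
        ; v = λ i → x (wrap i + a)
        ; ed = λ i → walk (wrap i + a) .edge
        ; v-period = λ i → cong (λ j → x (j + a)) (wrap-period i)
        ; ed-period = λ i → cong (λ j → walk (j + a) .edge) (wrap-period i)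
        ; joins = λ i → subst (Joins _ _) (x-next i) (walk (wrap i + a) .joins)
        ; distinct = λ i {d} 0<d d<p → x-injective (wrap-< (d + i)) (wrap-< i) (wrap-distinct i 0<d d<p)
        ; unc = λ i → walk (wrap i + a) .unc
        }
        where
        open Wrap (2 + r)
        a = FR.start
        x-next : ∀ i → x (suc (wrap i + a)) ≡ x (wrap (suc i) + a)
        x-next i with suc (wrap i) ℕ.≟ 3 + r
        ... | yes eq′ = trans (cong (λ j → x (j + a)) eq′) eq
        ... | no _    = refl
        x-injective : ∀ {i j} → i < 3 + r → j < 3 + r → i ≢ j → x (i + a) ≢ x (j + a)
        x-injective {i} {j} i<p j<p i≢j eq′ with ℕ.<-cmp i j
        ... | tri< i<j _ _ = inj (ℕ.+-monoˡ-< a i<j) (ℕ.+-monoˡ-< a j<p) eq′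
        ... | tri≈ _ i≡j _ = i≢j i≡j
        ... | tri> _ _ j<i = inj (ℕ.+-monoˡ-< a j<i) (ℕ.+-monoˡ-< a i<p) (sym eq′)

module _ {A : Set} {f : ℕ → A} {p : ℕ} (distinct : ∀ i {d} → 0 < d → d < p → f (d + i) ≢ f i) where

  window-< : ∀ i {s t} → s < t → t < p → f (s + i) ≢ f (t + i)
  window-< i {s} {t} s<t t<p eq = distinct (s + i) (ℕ.m<n⇒0<n∸m s<t) (ℕ.≤-<-trans (ℕ.m∸n≤m t s) t<p)
    (trans (cong f (trans (sym (ℕ.+-assoc (t ∸ s) s i)) (cong (_+ i) (ℕ.m∸n+n≡m (ℕ.<⇒≤ s<t))))) (sym eq))

  window-injective : ∀ i {s t} → s < p → t < p → f (s + i) ≡ f (t + i) → s ≡ t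
  window-injective i {s} {t} s<p t<p eq with ℕ.<-cmp s t
  ... | tri< s<t _ _ = contradiction eq (window-< i s<t t<p)
  ... | tri≈ _ s≡t _ = s≡t
  ... | tri> _ _ t<s = contradiction (sym eq) (window-< i t<s s<p)

parity : ∀ x → ∃ λ t → x ≡ t + t ⊎ x ≡ suc (t + t)
parity zero = 0 , inj₁ refl
parity (suc x) with parity x
... | t , inj₁ eq = t , inj₂ (cong suc eq)
... | t , inj₂ eq = suc t , inj₁ (cong suc (trans eq (sym (ℕ.+-suc t t))))

enumeration : ∀ {A : Set} {N} (f : ℕ → A) (index : A → ℕ) → (∀ a → index a < N) → (∀ a → f (index a) ≡ a) →
              (∀ {s t} → s < N → t < N → f s ≡ f t → s ≡ t) → A ↔ Fin N
enumeration f index index< f-index injective = mk↔ₛ′ (λ a → fromℕ< (index< a)) (λ i → f (toℕ i))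
  (λ i → Fin.toℕ-injective (trans (Fin.toℕ-fromℕ< _) (injective (index< _) (Fin.toℕ<n i) (f-index _))))
  (λ a → trans (cong f (Fin.toℕ-fromℕ< (index< a))) (f-index a))

-- Here `a`, `b`, `c` are the multiplicities of a triangle and `D` its maximum degree. The equation
-- says that `k + 1 + D` is the total number of edges. So each multiplicity is that total minus the
-- degree of the opposite vertex: at least `k + 1`, with equality opposite a vertex of degree `D`.
excess-of-triangle : ∀ {D k a b c} → suc (D + k + a) ≡ a + c + (b + a) → a + c ≤ D → b + a ≤ D → c + b ≤ D →
                     (D ≡ a + c ⊎ D ≡ b + a ⊎ D ≡ c + b) → k + 1 ≡ a ⊓ c ⊓ b
excess-of-triangle {D} {k} {a} {b} {c} eq x≤D y≤D z≤D max = ℕ.≤-antisym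
  (ℕ.⊓-glb (ℕ.⊓-glb (below total-a z≤D) (below total-c y≤D)) (below total-b x≤D)) (attained max)
  where
  total-a : k + 1 + D ≡ a + (c + b)
  total-a = ℕ.+-cancelʳ-≡ a _ _ (trans (lhs D k a) (trans eq (rhs a b c)))
    where
    lhs : ∀ D k a → k + 1 + D + a ≡ suc (D + k + a)
    lhs = solve-∀
    rhs : ∀ a b c → a + c + (b + a) ≡ a + (c + b) + a
    rhs = solve-∀
  total-c : k + 1 + D ≡ c + (b + a)
  total-c = trans total-a (rearrange a b c)
    where
    rearrange : ∀ a b c → a + (c + b) ≡ c + (b + a)
    rearrange = solve-∀
  total-b : k + 1 + D ≡ b + (a + c)
  total-b = trans total-a (rearrange a b c)
    where
    rearrange : ∀ a b c → a + (c + b) ≡ b + (a + c)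
    rearrange = solve-∀
  below : ∀ {x y} → k + 1 + D ≡ x + y → y ≤ D → k + 1 ≤ x
  below {x} {y} eq y≤D = ℕ.+-cancelʳ-≤ y _ _ (ℕ.≤-trans (ℕ.+-monoʳ-≤ (k + 1) y≤D) (ℕ.≤-reflexive eq))
  equal : ∀ {x y} → k + 1 + D ≡ x + y → D ≡ y → x ≡ k + 1
  equal eq refl = sym (ℕ.+-cancelʳ-≡ D _ _ eq)
  attained : D ≡ a + c ⊎ D ≡ b + a ⊎ D ≡ c + b → a ⊓ c ⊓ b ≤ k + 1
  attained (inj₁ D≡)        = ℕ.≤-trans (ℕ.m⊓n≤n (a ⊓ c) b) (ℕ.≤-reflexive (equal total-b D≡))
  attained (inj₂ (inj₁ D≡)) = ℕ.≤-trans (ℕ.m⊓n≤m (a ⊓ c) b) (ℕ.≤-trans (ℕ.m⊓n≤n a c) (ℕ.≤-reflexive (equal total-c D≡)))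
  attained (inj₂ (inj₂ D≡)) = ℕ.≤-trans (ℕ.m⊓n≤m (a ⊓ c) b) (ℕ.≤-trans (ℕ.m⊓n≤m a c) (ℕ.≤-reflexive (equal total-a D≡)))

-- Vertices, edges and arcs of a cycle

module CycleFacts (G : Multigraph) {Unc : Fin (Multigraph.m G) → Set} (C : GraphFacts.Cycle G Unc) where
  open Multigraph G
  open GraphFacts G
  open Cycle C public
  open import Data.List.Membership.DecPropositional (Fin._≟_ {m}) using (_∈?_)

  distinct′ : ∀ i {d} → 0 < d → d < 3 + r → v (suc (d + i)) ≢ v (suc i)
  distinct′ i {d} 0<d d<ℓ eq = distinct (suc i) 0<d d<ℓ (trans (cong v (ℕ.+-suc d i)) eq)

  v-next : ∀ i {d} → 0 < d → d < 3 + r → v (d + i) ≡ v (suc i) → d ≡ 1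
  v-next i {suc zero}    _ _   _  = refl
  v-next i {suc (suc d)} _ d<ℓ eq = contradiction eq (distinct′ i z<s (ℕ.<⇒≤ d<ℓ))

  ed-incˡ : ∀ i → Inc G (ed i) (v i)
  ed-incˡ i = Joins⇒Incˡ (joins i)

  ed-incʳ : ∀ i → Inc G (ed i) (v (suc i))
  ed-incʳ i = Joins⇒Incʳ (joins i)

  -- Equal edges have the same ends. Distinctness of the vertices leaves only `d = 1` with the edge
  -- reversed, which would identify `v (2 + i)` with `v i`.
  ed-distinct : ∀ i {d} → 0 < d → d < 3 + r → ed (d + i) ≢ ed i
  ed-distinct i {d} 0<d d<ℓ eq
    with Joins-ends (joins i) (subst (λ e → Inc G e _) eq (ed-incˡ (d + i)))
       | Joins-ends (joins i) (subst (λ e → Inc G e _) eq (ed-incʳ (d + i)))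
  ... | inj₁ eq₁ | _        = distinct i 0<d d<ℓ eq₁
  ... | inj₂ eq₁ | inj₂ eq₂ = distinct′ i 0<d d<ℓ eq₂
  ... | inj₂ eq₁ | inj₁ eq₂ with refl ← v-next i 0<d d<ℓ eq₁ = distinct i {2} z<s (s<s (s<s z<s)) eq₂

  v-injective : ∀ i {s t} → s < 3 + r → t < 3 + r → v (s + i) ≡ v (t + i) → s ≡ t
  v-injective = window-injective distinct

  ed-injective : ∀ i {s t} → s < 3 + r → t < 3 + r → ed (s + i) ≡ ed (t + i) → s ≡ t
  ed-injective = window-injective ed-distinct

  ed-adj : ∀ i → AdjL G (ed (suc i)) (ed i)
  ed-adj i = ed-distinct i {1} z<s (s<s z<s) , v (suc i) , ed-incˡ (suc i) , ed-incʳ i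

  ed-adj⁻ : ∀ i {d} → 0 < d → d < 3 + r → AdjL G (ed i) (ed (d + i)) → d ≡ 1 ⊎ suc d ≡ 3 + r
  ed-adj⁻ i {d} 0<d d<ℓ (_ , x , inc₁ , inc₂) with Joins-ends (joins i) inc₁ | Joins-ends (joins (d + i)) inc₂
  ... | inj₁ refl | inj₁ eq = contradiction (sym eq) (distinct i 0<d d<ℓ)
  ... | inj₂ refl | inj₁ eq = inj₁ (v-next i 0<d d<ℓ (sym eq))
  ... | inj₂ refl | inj₂ eq = contradiction (sym eq) (distinct′ i 0<d d<ℓ)
  ... | inj₁ refl | inj₂ eq with suc d ℕ.≟ 3 + r
  ...   | yes 1+d≡ℓ = inj₂ 1+d≡ℓ
  ...   | no 1+d≢ℓ  = contradiction (sym eq) (distinct i z<s (ℕ.≤∧≢⇒< d<ℓ 1+d≢ℓ))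

  v-cover : ∀ i j → ∃ λ s → s < 3 + r × v j ≡ v (s + i)
  v-cover = periodic-cover v-period

  ed-cover : ∀ i j → ∃ λ s → s < 3 + r × ed j ≡ ed (s + i)
  ed-cover = periodic-cover ed-period

  -- Facts about cycle vertices are stated at successor positions; this brings an arbitrary position
  -- into that form.
  v-pred : ∀ j → v j ≡ v (suc (2 + r + j))
  v-pred j = sym (v-period j)

  OnCycle : Fin m → Set
  OnCycle e = ∃ λ j → e ≡ ed j

  -- The latest edge comes first, so that the list is a run towards `ed i`. It has `t + 1` entries:
  -- `arc i (2 + r)` is the whole cycle, and `arc (2 + i) (1 + r)` omits only `ed (1 + i)`.
  arc : ℕ → ℕ → List (Fin m)
  arc i zero    = ed i ∷ []
  arc i (suc t) = ed (suc t + i) ∷ arc i t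

  ∈-arc⁺ : ∀ i t {s} → s ≤ t → ed (s + i) ∈ arc i t
  ∈-arc⁺ i zero        z≤n = here refl
  ∈-arc⁺ i (suc t) {s} s≤t with s ℕ.≟ suc t
  ... | yes refl = here refl
  ... | no s≢t   = there (∈-arc⁺ i t (ℕ.s≤s⁻¹ (ℕ.≤∧≢⇒< s≤t s≢t)))

  ∈-arc⁻ : ∀ i t {e} → e ∈ arc i t → ∃ λ s → s ≤ t × e ≡ ed (s + i)
  ∈-arc⁻ i zero    (here eq)  = 0 , z≤n , eq
  ∈-arc⁻ i (suc t) (here eq)  = suc t , ℕ.≤-refl , eq
  ∈-arc⁻ i (suc t) (there e∈) = let (s , s≤t , eq) = ∈-arc⁻ i t e∈ in s , ℕ.m≤n⇒m≤1+n s≤t , eq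

  arc-unc : ∀ i t → All Unc (arc i t)
  arc-unc i zero    = unc i ∷ []
  arc-unc i (suc t) = unc (suc t + i) ∷ arc-unc i t

  arc-unique : ∀ i t → t < 3 + r → Unique (arc i t)
  arc-unique i zero    _   = [] ∷ []
  arc-unique i (suc t) t<ℓ = ¬Any⇒All¬ (arc i t) fresh ∷ arc-unique i t (ℕ.<⇒≤ t<ℓ)
    where
    fresh : ed (suc t + i) ∉ arc i t
    fresh e∈ with ∈-arc⁻ i t e∈
    ... | s , s≤t , eq = ℕ.<⇒≢ (s≤s s≤t) (sym (ed-injective i t<ℓ (ℕ.≤-<-trans s≤t (ℕ.<⇒≤ t<ℓ)) eq))

  ∈-full-arc : ∀ {e} i → OnCycle e → e ∈ arc i (2 + r)
  ∈-full-arc i (j , refl) with ed-cover i j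
  ... | s , s<ℓ , eq = subst (_∈ arc i (2 + r)) (sym eq) (∈-arc⁺ i (2 + r) (ℕ.s≤s⁻¹ s<ℓ))

  onCycle? : ∀ e → Dec (OnCycle e)
  onCycle? e = map′ (λ e∈ → let (s , _ , eq) = ∈-arc⁻ 0 (2 + r) e∈ in s + 0 , eq) (∈-full-arc 0) (e ∈? arc 0 (2 + r))

  onCycle-at : ∀ i {e} → OnCycle e → Inc G e (v (suc i)) → e ≡ ed i ⊎ e ≡ ed (suc i)
  onCycle-at i (j , refl) inc with ed-cover i j
  ... | zero        , _   , eq = inj₁ eq
  ... | suc zero    , _   , eq = inj₂ eq
  ... | suc (suc s) , s<ℓ , eq with Joins-ends (joins (2 + s + i)) (subst (λ e → Inc G e _) eq inc)
  ...   | inj₁ eq₁ = contradiction (sym eq₁) (distinct′ i z<s (ℕ.<⇒≤ s<ℓ))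
  ...   | inj₂ eq₂ = contradiction (sym eq₂) (distinct′ i z<s s<ℓ)

  ed-wrap : ∀ i → ed (suc r + (2 + i)) ≡ ed i
  ed-wrap i = trans (cong ed (trans (ℕ.+-suc (suc r) (suc i)) (cong suc (ℕ.+-suc (suc r) i)))) (ed-period i)

  arc-avoids : ∀ i → ed (1 + i) ∉ arc (2 + i) (1 + r)
  arc-avoids i e∈ with ∈-arc⁻ (2 + i) (1 + r) e∈
  ... | s , s≤ , eq = ed-distinct (1 + i) {suc s} z<s (s≤s (s≤s s≤)) (trans (cong ed (sym (ℕ.+-suc s (1 + i)))) (sym eq))

  ∈-arc-rest : ∀ i {e} → OnCycle e → e ≢ ed (1 + i) → e ∈ arc (2 + i) (1 + r)
  ∈-arc-rest i (j , refl) e≢ with ed-cover (1 + i) j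
  ... | zero  , _   , eq = contradiction eq e≢
  ... | suc s , s<ℓ , eq = subst (_∈ arc (2 + i) (1 + r)) (trans (cong ed (ℕ.+-suc s (1 + i))) (sym eq))
                             (∈-arc⁺ (2 + i) (1 + r) (ℕ.s≤s⁻¹ (ℕ.s≤s⁻¹ s<ℓ)))

  1≤mult : ∀ i → 1 ≤ mult G (v i) (v (1 + i))
  1≤mult i = subst (1 ≤_) (sym (mult≡ _ _))
    (length-≤-count (inc₂? (v i) (v (1 + i))) ([] ∷ []) ((ed-incˡ i , ed-incʳ i) ∷ []))

  module Spanning (connected : Connected G) (closed : ∀ j {e w} → Joins e (v (1 + j)) w → ∃ λ i → w ≡ v i) where

    -- By connectedness `u` is reached by a walk from `v 1`, and by `closed` such a walk never
    -- leaves the cycle.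
    spanning : ∀ u → ∃ λ s → s < 3 + r × u ≡ v (s + 0)
    spanning u = let (j , eq) = along (1 , refl) (connected (v 1) u)
                     (s , s<ℓ , eq′) = v-cover 0 j in s , s<ℓ , trans eq eq′
      where
      along : ∀ {x u} → (∃ λ j → x ≡ v j) → Reach G x u → ∃ λ j → u ≡ v j
      along on here = on
      along (j , refl) (step e j′ walk) = along (closed _ (subst (λ x → Joins e x _) (v-pred j) j′)) walk

    index : Fin n → ℕ
    index u = proj₁ (spanning u)

    index-< : ∀ u → index u < 3 + r
    index-< u = proj₁ (proj₂ (spanning u))

    v-index : ∀ u → v (index u + 0) ≡ u
    v-index u = sym (proj₂ (proj₂ (spanning u)))

    n≡length : n ≡ 3 + r
    n≡length = ℕ.≤-antisym
      (Fin.injective⇒≤ {f = λ u → fromℕ< (index-< u)} λ {x} {y} eq → begin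
        x                  ≡⟨ v-index x ⟨
        v (index x + 0)    ≡⟨ cong (λ s → v (s + 0)) (Fin.fromℕ<-injective _ _ (index-< x) (index-< y) eq) ⟩
        v (index y + 0)    ≡⟨ v-index y ⟩
        y                  ∎)
      (Fin.injective⇒≤ {f = λ (s : Fin (3 + r)) → v (toℕ s + 0)} λ {s} {t} eq →
        Fin.toℕ-injective (v-injective 0 (Fin.toℕ<n s) (Fin.toℕ<n t) eq))
      where open ≡-Reasoning

  -- Graphs that consist of a cycle alone

  module WholeCycle (connected : Connected G) (at : ∀ i {e} → Inc G e (v (1 + i)) → e ≡ ed i ⊎ e ≡ ed (1 + i)) where

    private
      closed : ∀ j {e w} → Joins e (v (1 + j)) w → ∃ λ i → w ≡ v i
      closed j joined with at j (Joins⇒Incˡ joined)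
      ... | inj₁ refl = Sum.[ (λ eq → _ , eq) , (λ eq → _ , eq) ]′ (Joins-ends (joins j) (Joins⇒Incʳ joined))
      ... | inj₂ refl = Sum.[ (λ eq → _ , eq) , (λ eq → _ , eq) ]′ (Joins-ends (joins (1 + j)) (Joins⇒Incʳ joined))

    open Spanning connected closed public

    all-on-cycle : ∀ e → OnCycle e
    all-on-cycle e = Sum.[ (λ eq → _ , eq) , (λ eq → _ , eq) ]′ (at (2 + r + (index (proj₁ (ends e)) + 0))
      (subst (Inc G e) (trans (sym (v-index (proj₁ (ends e)))) (v-pred _)) (inj₁ refl)))

    position : ∀ e → ∃ λ s → s < 3 + r × e ≡ ed (s + 0)
    position e = let (j , eq) = all-on-cycle e
                     (s , s<ℓ , eq′) = ed-cover 0 j in s , s<ℓ , trans eq eq′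

    vertices : Fin n ↔ Fin n
    vertices = enumeration (λ s → v (s + 0)) index (λ u → subst (index u <_) (sym n≡length) (index-< u)) v-index
      λ s<n t<n → v-injective 0 (subst (_ <_) n≡length s<n) (subst (_ <_) n≡length t<n)

    edges : Fin m ↔ Fin n
    edges = enumeration (λ s → ed (s + 0)) (λ e → proj₁ (position e))
      (λ e → subst (proj₁ (position e) <_) (sym n≡length) (proj₁ (proj₂ (position e)))) (λ e → sym (proj₂ (proj₂ (position e))))
      λ s<n t<n → ed-injective 0 (subst (_ <_) n≡length s<n) (subst (_ <_) n≡length t<n)

    joined : ∀ e i j → Inverse.to edges e ≡ i → Consec G i j →
             Joins e (Inverse.to (↔-sym vertices) i) (Inverse.to (↔-sym vertices) j)
    joined e i j refl consec = subst₂ (λ f u → Joins f (v (toℕ i + 0)) u)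
      (Inverse.strictlyInverseʳ edges e) (sym (next consec)) (joins (toℕ i + 0))
      where
      next : Consec G i j → v (toℕ j + 0) ≡ v (suc (toℕ i + 0))
      next (inj₁ eq)         = cong (λ s → v (s + 0)) eq
      next (inj₂ (eq , eq₀)) = trans (cong (λ s → v (s + 0)) eq₀)
        (trans (sym (v-period 0)) (cong (λ s → v (s + 0)) (sym (trans eq n≡length))))

    parallel : ∀ i {g} → Inc G g (v (1 + i)) → Inc G g (v (2 + i)) → g ≡ ed (1 + i)
    parallel i {g} inc₁ inc₂ with at i inc₁
    ... | inj₂ eq   = eq
    ... | inj₁ refl with Joins-ends (joins i) inc₂
    ...   | inj₁ eq = contradiction eq (distinct i {2} z<s (s<s (s<s z<s)))
    ...   | inj₂ eq = contradiction eq (distinct (1 + i) {1} z<s (s<s z<s))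

    simple : Simple G
    simple e f e≢f same with position e
    ... | s , _ , refl = e≢f (trans (sym e≡) (sym (parallel i (shared (ed-incˡ (1 + i))) (shared (ed-incʳ (1 + i))))))
      where
      -- `1 + i` lies one full period after the position of `e`, which gives that position the
      -- successor form used by `parallel`.
      i = 2 + r + (s + 0)
      e≡ : ed (1 + i) ≡ ed (s + 0)
      e≡ = ed-period (s + 0)
      transfer : ∀ {g h : Fin m} {x} → (ends g ≡ ends h) ⊎ (ends g ≡ (proj₂ (ends h) , proj₁ (ends h))) →
                 Inc G g x → Inc G h x
      transfer (inj₁ eq) (inj₁ inc) = inj₁ (trans (sym (cong proj₁ eq)) inc)
      transfer (inj₁ eq) (inj₂ inc) = inj₂ (trans (sym (cong proj₂ eq)) inc)
      transfer (inj₂ eq) (inj₁ inc) = inj₂ (trans (sym (cong proj₁ eq)) inc)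
      transfer (inj₂ eq) (inj₂ inc) = inj₁ (trans (sym (cong proj₂ eq)) inc)
      shared : ∀ {x} → Inc G (ed (1 + i)) x → Inc G f x
      shared inc = transfer {e} same (subst (λ g → Inc G g _) e≡ inc)

    isCycle : IsCycle G
    -- `vertices` sends a vertex to its position, whereas the definition asks for the vertex at a
    -- position, hence the inverse.
    isCycle = subst (3 ≤_) (sym n≡length) (s≤s (s≤s (s≤s z≤n))) , ↔-sym vertices , edges , joined

-- Partial colourings without progress

module Stuck (G : Multigraph) (k : ℕ) (ΔL≤ : ΔL G ≤ Δ G + k) where
  open Multigraph G
  open GraphFacts G

  K : ℕ
  K = Δ G + k

  open DegreeColouring {K = K} adjL? adjL-sym adjL-irrefl
    (λ e → subst (_≤ K) (degreeL≡ e) (ℕ.≤-trans (degreeL≤ΔL e) ΔL≤)) public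

  colouredAt? : ∀ φ v e → Dec (Inc G e v × ¬ Unc φ e)
  colouredAt? φ v e = inc? e v ×-dec ¬? (unc? φ e)

  uncAt? : ∀ φ v e → Dec (Inc G e v × Unc φ e)
  uncAt? φ v e = inc? e v ×-dec unc? φ e

  -- The bound is kept only at vertices that still meet an uncoloured edge; a vertex whose edges
  -- have all been coloured may exceed `k`.
  Bounded : Partial → Set
  Bounded φ = ∀ {e v} → Unc φ e → Inc G e v → count (colouredAt? φ v) ≤ k

  module _ {φ : Partial} (proper : Proper φ) (bounded : Bounded φ) (stuck : ¬ Progress φ) where

    degreeL-tight : ∀ {e} → Unc φ e → degreeL G e ≡ K
    degreeL-tight {e} unc = ℕ.≤-antisym (ℕ.≤-trans (degreeL≤ΔL e) ΔL≤) (ℕ.≮⇒≥ λ d<K →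
      stuck (slack-progress proper unc (degree<K⇒slack φ e (subst (_< K) (degreeL≡ e) d<K))))

    -- A colour repeated around an uncoloured edge would make that edge slack.
    no-repeat : ∀ {e f g c} → Unc φ e → AdjL G e f → AdjL G e g → φ f ≡ just c → φ g ≡ just c → f ≡ g
    no-repeat {e} {f} {g} unc adjf adjg eqf eqg = decidable-stable (f Fin.≟ g) λ f≢g →
      stuck (slack-progress proper unc (repeated⇒slack φ e f≢g adjf adjg eqf eqg))

    -- Tightness makes the degrees of `u` and `v` add up to `Δ G + k + 1 + mult G u v`, and `v`
    -- contributes at most `Δ G`.
    degree-large : ∀ {e u v} → Unc φ e → Joins e u v → suc (k + mult G u v) ≤ degree G u
    degree-large {e} {u} {v} unc j = ℕ.+-cancelˡ-≤ (Δ G) _ _ (begin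
      Δ G + suc (k + mult G u v)      ≡⟨ ℕ.+-suc (Δ G) _ ⟩
      suc (Δ G + (k + mult G u v))    ≡⟨ cong suc (ℕ.+-assoc (Δ G) k _) ⟨
      suc (K + mult G u v)            ≡⟨ cong (λ d → suc (d + mult G u v)) (degreeL-tight unc) ⟨
      suc (degreeL G e + mult G u v)  ≡⟨ degreeL-formula j ⟩
      degree G u + degree G v         ≤⟨ ℕ.+-monoʳ-≤ (degree G u) (degree≤Δ v) ⟩
      degree G u + Δ G                ≡⟨ ℕ.+-comm (degree G u) (Δ G) ⟩
      Δ G + degree G u                ∎)
      where open ℕ.≤-Reasoning

    degree-split : ∀ v → degree G v ≡ count (uncAt? φ v) + count (colouredAt? φ v)
    degree-split v = trans (degree≡ v) (count-split (λ e → inc? e v) (unc? φ))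

    -- If all uncoloured edges at `v` led back to `u`, then with at most `k` coloured edges the
    -- degree of `v` would be at most `k + mult G v u`, less than `degree-large` demands.
    continue : ∀ {e u v} → Unc φ e → Joins e u v → ∃₂ λ f w → Unc φ f × Joins f v w × w ≢ u
    continue {e} {u} {v} ue j with Fin.any? (λ f → uncAt? φ v f ×-dec ¬? (inc? f u))
    ... | yes (f , (fv , uf) , ¬fu) =
      let (w , j′) = Inc⇒Joins fv in f , w , uf , j′ , λ { refl → ¬fu (Joins⇒Incʳ j′) }
    ... | no ¬any = contradiction (degree-large ue (Joins-sym j)) (ℕ.<⇒≱ (s≤s (begin
      degree G v                                     ≡⟨ degree-split v ⟩
      count (uncAt? φ v) + count (colouredAt? φ v)   ≤⟨ ℕ.+-mono-≤
        (count-mono (uncAt? φ v) (inc₂? v u) λ f (fv , uf) →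
          fv , decidable-stable (inc? f u) λ ¬fu → ¬any (f , (fv , uf) , ¬fu))
        (bounded ue (Joins⇒Incʳ j)) ⟩
      count (inc₂? v u) + k                          ≡⟨ cong (_+ k) (mult≡ v u) ⟨
      mult G v u + k                                 ≡⟨ ℕ.+-comm _ k ⟩
      k + mult G v u                                 ∎)))
      where open ℕ.≤-Reasoning

    -- Edges and colours around an uncoloured cycle

    module OnUncolouredCycle (C : Cycle (Unc φ)) where
      open CycleFacts G C

      arc-run : ∀ i t → Run (_≡ ed i) (arc i t)
      arc-run i zero          = inj₁ refl ∷ []
      arc-run i (suc t)       = inj₂ (_ , ∈-arc⁺ i t ℕ.≤-refl , ed-adj (t + i)) ∷ arc-run i t

      -- Here ed (1 + i) has the three neighbours ed i, ed (2 + i) and f, whereas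
      -- ed (2 + i) is adjacent to ed (1 + i) and ed (3 + i) only.
      no-pendant : ∀ i {f w} → Unc φ f → Joins f (v (1 + i)) w → ¬ OnCycle f →
                   w ≢ v (2 + i) → w ≢ v (3 + i) → ⊥
      no-pendant i {f} {w} uf joins-f f∉C w≢₂ w≢₃ = stuck (core-progress
        {ne = ed i ∷ ed (2 + i) ∷ f ∷ []} {nf = ed (1 + i) ∷ ed (3 + i) ∷ []} proper
        (unc (1 + i) ∷ uf ∷ arc-unc (2 + i) (1 + r))
        (¬Any⇒All¬ _ (λ { (here eq) → f∉C (1 + i , sym eq) ; (there e∈) → arc-avoids i e∈ })
          ∷ ¬Any⇒All¬ _ (λ f∈ → f∉C (let (s , _ , eq) = ∈-arc⁻ (2 + i) (1 + r) f∈ in _ , eq))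
          ∷ arc-unique (2 + i) (1 + r) (ℕ.n≤1+n _))
        (there (∈-arc⁺ (2 + i) (1 + r) {0} z≤n))
        (inj₂ (_ , e₀∈ , f~ed i (ed-incʳ i)) ∷ arc-run (2 + i) (1 + r))
        (adjL-sym (ed-adj (1 + i)))
        (((λ eq → ed-distinct i {2} z<s (s<s (s<s z<s)) (sym eq)) ∷ (λ eq → f∉C (i , sym eq)) ∷ [])
          ∷ ((λ eq → f∉C (2 + i , sym eq)) ∷ []) ∷ [] ∷ [])
        ((there e₀∈ , ed-adj i)
          ∷ (there (∈-arc⁺ (2 + i) (1 + r) {0} z≤n) , adjL-sym (ed-adj (1 + i)))
          ∷ (here refl , adjL-sym (f~ed (1 + i) (ed-incˡ (1 + i)))) ∷ [])
        (λ { (here refl) _ → here refl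
           ; (there (here refl)) (_ , x , x₂ , xf) → ⊥-elim (f≁e₂ x₂ xf)
           ; (there (there g∈)) adj → there (here (in-arc g∈ adj)) })
        ℕ.≤-refl)
        where
        f~ed : ∀ j → Inc G (ed j) (v (1 + i)) → AdjL G f (ed j)
        f~ed j inc = (λ eq → f∉C (j , eq)) , v (1 + i) , Joins⇒Incˡ joins-f , inc
        e₀∈ : ed i ∈ arc (2 + i) (1 + r)
        e₀∈ = subst (_∈ arc (2 + i) (1 + r)) (ed-wrap i) (∈-arc⁺ (2 + i) (1 + r) ℕ.≤-refl)
        f≁e₂ : ∀ {x} → Inc G (ed (2 + i)) x → ¬ Inc G f x
        f≁e₂ inc₂ inc with Joins-ends (joins (2 + i)) inc₂ | Joins-ends joins-f inc
        ... | inj₁ refl | inj₁ eq = distinct (1 + i) {1} z<s (s<s z<s) eq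
        ... | inj₁ refl | inj₂ eq = w≢₂ (sym eq)
        ... | inj₂ refl | inj₁ eq = distinct (1 + i) {2} z<s (s<s (s<s z<s)) eq
        ... | inj₂ refl | inj₂ eq = w≢₃ (sym eq)
        in-arc : ∀ {g} → g ∈ arc (2 + i) (1 + r) → AdjL G (ed (2 + i)) g → g ≡ ed (3 + i)
        in-arc g∈ adj with ∈-arc⁻ (2 + i) (1 + r) g∈
        ... | zero  , _ , refl = contradiction adj adjL-irrefl
        ... | suc s , s≤ , refl with ed-adj⁻ (2 + i) {suc s} z<s (s≤s (ℕ.m≤n⇒m≤1+n s≤)) adj
        ...   | inj₁ refl = refl
        ...   | inj₂ eq   = contradiction eq (ℕ.<⇒≢ (s≤s (s≤s s≤)))

      -- A diagonal `f` of a 4-cycle is adjacent to all four cycle edges, whereas `ed (1 + i)` has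
      -- only three neighbours among `f` and the cycle. So `f` with the cycle is an uneven core.
      no-chord : r ≡ 1 → ∀ i {f} → Unc φ f → Joins f (v (1 + i)) (v (3 + i)) → OnCycle f
      no-chord r≡1 i {f} uf joins-f = decidable-stable (onCycle? f) λ f∉C → stuck (core-progress
        {ne = arc (1 + i) 3} {nf = ed (2 + i) ∷ ed (4 + i) ∷ f ∷ []} proper
        (uf ∷ arc-unc (1 + i) 3)
        (¬Any⇒All¬ _ (λ f∈ → f∉C (let (s , _ , eq) = ∈-arc⁻ (1 + i) 3 f∈ in _ , eq))
          ∷ arc-unique (1 + i) 3 (subst (λ r → 3 < 3 + r) (sym r≡1) ℕ.≤-refl))
        (∈-arc⁺ (1 + i) 3 {0} z≤n) (arc-run (1 + i) 3)
        (f~ed f∉C 1 (inj₁ refl) (ed-incˡ (1 + i)))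
        (arc-unique (1 + i) 3 (subst (λ r → 3 < 3 + r) (sym r≡1) ℕ.≤-refl))
        ((∈-arc⁺ (1 + i) 3 {3} ℕ.≤-refl , f~ed f∉C 4 (inj₁ (sym v₅≡v₁)) (ed-incʳ (4 + i)))
          ∷ (∈-arc⁺ (1 + i) 3 {2} (s≤s (s≤s z≤n)) , f~ed f∉C 3 (inj₂ refl) (ed-incˡ (3 + i)))
          ∷ (∈-arc⁺ (1 + i) 3 {1} (s≤s z≤n) , f~ed f∉C 2 (inj₂ refl) (ed-incʳ (2 + i)))
          ∷ (∈-arc⁺ (1 + i) 3 {0} z≤n , f~ed f∉C 1 (inj₁ refl) (ed-incˡ (1 + i))) ∷ [])
        (λ { (here refl) _ → there (there (here refl)) ; (there g∈) adj → in-arc g∈ adj })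
        ℕ.≤-refl)
        where
        v₅≡v₁ : v (5 + i) ≡ v (1 + i)
        v₅≡v₁ = subst (λ r → v (3 + r + (1 + i)) ≡ v (1 + i)) r≡1 (v-period (1 + i))
        f~ed : ¬ OnCycle f → ∀ j {x} → v (1 + i) ≡ x ⊎ v (3 + i) ≡ x → Inc G (ed (j + i)) x → AdjL G f (ed (j + i))
        f~ed f∉C j (inj₁ refl) inc = (λ eq → f∉C (_ , eq)) , _ , Joins⇒Incˡ joins-f , inc
        f~ed f∉C j (inj₂ refl) inc = (λ eq → f∉C (_ , eq)) , _ , Joins⇒Incʳ joins-f , inc
        in-arc : ∀ {g} → g ∈ arc (1 + i) 3 → AdjL G (ed (1 + i)) g → g ∈ ed (2 + i) ∷ ed (4 + i) ∷ f ∷ []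
        in-arc (here refl)                             _   = there (here refl)
        in-arc (there (there (here refl)))             _   = here refl
        in-arc (there (there (there (here refl)))) adj = contradiction adj adjL-irrefl
        in-arc (there (here refl))                 adj with ed-adj⁻ (1 + i) {2} z<s (s<s (s<s z<s)) adj
        ... | inj₂ eq with () ← trans eq (cong (3 +_) r≡1)

      -- If the far end `w` is neither `v (2 + i)` nor `v (3 + i)`, `no-pendant` applies. Otherwise
      -- it applies from the far end, given length at least 4 if `w` is `v (2 + i)` and at least 5
      -- if `w` is `v (3 + i)`. The diagonal of a 4-cycle remains for `no-chord`.
      uncoloured-on-cycle : 1 ≤ r → ∀ i {f} → Unc φ f → Inc G f (v (1 + i)) → OnCycle f
      uncoloured-on-cycle 1≤r i {f} uf inc with Inc⇒Joins inc
      ... | w , j with w Fin.≟ v (2 + i) | w Fin.≟ v (3 + i)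
      ...   | no w≢₂   | no w≢₃   = decidable-stable (onCycle? f) λ f∉C → no-pendant i uf j f∉C w≢₂ w≢₃
      ...   | yes refl | _        = decidable-stable (onCycle? f) λ f∉C → no-pendant (1 + i) uf (Joins-sym j) f∉C
        (distinct (1 + i) {2} z<s (s<s (s<s z<s)) ∘ sym) (distinct (1 + i) {3} z<s (s<s (s<s (s<s 1≤r))) ∘ sym)
      ...   | no _     | yes refl with r ℕ.≟ 1
      ...     | yes r≡1 = no-chord r≡1 i uf j
      ...     | no r≢1  = decidable-stable (onCycle? f) λ f∉C → no-pendant (2 + i) uf (Joins-sym j) f∉C
        (distinct (1 + i) {3} z<s (s<s (s<s (s<s 1≤r))) ∘ sym)
        (distinct (1 + i) {4} z<s (s<s (s<s (s<s (ℕ.≤∧≢⇒< 1≤r (r≢1 ∘ sym))))) ∘ sym)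

      triangle-period : r ≡ 0 → ∀ i → v (3 + i) ≡ v i
      triangle-period r≡0 i = subst (λ r → v (3 + r + i) ≡ v i) r≡0 (v-period i)

      uncoloured-in-triangle : r ≡ 0 → ∀ i {f w} → Unc φ f → Joins f (v (1 + i)) w → w ≡ v (2 + i) ⊎ w ≡ v (3 + i)
      uncoloured-in-triangle r≡0 i {f} {w} uf j with w Fin.≟ v (2 + i) | w Fin.≟ v (3 + i)
      ... | yes eq | _      = inj₁ eq
      ... | no _   | yes eq = inj₂ eq
      ... | no w≢₂ | no w≢₃ with onCycle? f
      ...   | no f∉C = ⊥-elim (no-pendant i uf j f∉C w≢₂ w≢₃)
      ...   | yes f∈C with onCycle-at i f∈C (Joins⇒Incˡ j)
      ...     | inj₁ refl with Joins-ends (joins i) (Joins⇒Incʳ j)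
      ...       | inj₁ eq = contradiction (trans eq (sym (triangle-period r≡0 i))) w≢₃
      ...       | inj₂ eq = contradiction (sym eq) (Joins⇒≢ j)
      uncoloured-in-triangle r≡0 i {f} {w} uf j | no w≢₂ | no _ | yes _ | inj₂ refl with Joins-ends (joins (1 + i)) (Joins⇒Incʳ j)
      ...       | inj₁ eq = contradiction (sym eq) (Joins⇒≢ j)
      ...       | inj₂ eq = contradiction eq w≢₂

      -- A colour free at one cycle edge and blocked at the next gives progress. On a long cycle the
      -- other cycle edges form the run. In a triangle `ed (2 + i)` alone suffices, since every
      -- other uncoloured neighbour of `ed (1 + i)` meets it.
      free-next : ∀ i {c} → Free φ (ed (1 + i)) c → Free φ (ed (2 + i)) c
      free-next i {c} free = decidable-stable (free? φ (ed (2 + i)) c) λ ¬free → stuck (progress ¬free)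
        where
        progress : ¬ Free φ (ed (2 + i)) c → Progress φ
        progress ¬free with r ℕ.≟ 0
        ... | no r≢0 = lists-differ-progress {f = ed (2 + i)} proper (unc (1 + i)) (arc-unc (2 + i) (1 + r))
            (arc-unique (2 + i) (1 + r) (ℕ.n≤1+n _)) (arc-avoids i)
            (∈-arc⁺ (2 + i) (1 + r) {0} z≤n) (arc-run (2 + i) (1 + r)) (adjL-sym (ed-adj (1 + i)))
            (λ { ug adj@(e≢g , _ , inc₁ , inc) → inj₁ (∈-arc-rest i (on-cycle ug inc₁ inc) (e≢g ∘ sym)) }) free ¬free
          where
          on-cycle : ∀ {g x} → Unc φ g → Inc G (ed (1 + i)) x → Inc G g x → OnCycle g
          on-cycle ug inc₁ inc with Joins-ends (joins (1 + i)) inc₁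
          ... | inj₁ refl = uncoloured-on-cycle (ℕ.n≢0⇒n>0 r≢0) i ug inc
          ... | inj₂ refl = uncoloured-on-cycle (ℕ.n≢0⇒n>0 r≢0) (1 + i) ug inc
        ... | yes r≡0 = lists-differ-progress {f = ed (2 + i)} proper (unc (1 + i)) (unc (2 + i) ∷ []) ([] ∷ [])
            (λ { (here eq) → proj₁ (ed-adj (1 + i)) (sym eq) }) (here refl) (inj₁ refl ∷ [])
            (adjL-sym (ed-adj (1 + i))) (λ ug (_ , _ , inc₁ , inc) → near ug inc₁ inc) free ¬free
          where
          near : ∀ {g x} → Unc φ g → Inc G (ed (1 + i)) x → Inc G g x →
                 g ∈ ed (2 + i) ∷ [] ⊎ ∃ λ h → h ∈ ed (2 + i) ∷ [] × AdjL G g h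
          near {g} ug inc₁ inc with g Fin.≟ ed (2 + i)
          ... | yes eq = inj₁ (here eq)
          ... | no g≢ with Joins-ends (joins (1 + i)) inc₁
          ...   | inj₂ refl = inj₂ (_ , here refl , g≢ , _ , inc , ed-incˡ (2 + i))
          ...   | inj₁ refl with Inc⇒Joins inc
          ...     | w , j with uncoloured-in-triangle r≡0 i ug j
          ...       | inj₁ refl = inj₂ (_ , here refl , g≢ , _ , Joins⇒Incʳ j , ed-incˡ (2 + i))
          ...       | inj₂ refl = inj₂ (_ , here refl , g≢ , _ , Joins⇒Incʳ j , ed-incʳ (2 + i))

      free-shift : ∀ d i {c} → Free φ (ed (1 + i)) c → Free φ (ed (1 + (d + i))) c
      free-shift zero    i free = free
      free-shift (suc d) i free = free-next (d + i) (free-shift d i free)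

      free-everywhere : ∀ j {c} → Free φ (ed 1) c → Free φ (ed j) c
      free-everywhere j {c} free = subst (λ e → Free φ e c)
        (trans (cong (λ x → ed (1 + x)) (ℕ.+-identityʳ (2 + r + j))) (ed-period j)) (free-shift (2 + r + j) 0 free)

      -- One step back is `2 + r` steps forward around the cycle.
      free-prev : ∀ i {c} → Free φ (ed (2 + i)) c → Free φ (ed (1 + i)) c
      free-prev i {c} free = subst (λ e → Free φ e c) (ed-period (1 + i)) (free-shift (2 + r) (1 + i) free)

      Seen : Fin K → ℕ → Set
      Seen c i = ∃ λ g → Inc G g (v i) × φ g ≡ just c

      seen-blocks : ∀ i {c} → Seen c (1 + i) → ¬ Free φ (ed (1 + i)) c
      seen-blocks i (g , inc , eq) free =
        free g ((λ { refl → unc-just {φ} (unc (1 + i)) eq }) , _ , ed-incˡ (1 + i) , inc) eq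

      seen-both : ∀ i {c g h} → Inc G g (v i) → φ g ≡ just c → Inc G h (v (1 + i)) → φ h ≡ just c → g ≡ h
      seen-both i incg eqg inch eqh = no-repeat (unc i)
        ((λ { refl → unc-just {φ} (unc i) eqg }) , _ , ed-incˡ i , incg)
        ((λ { refl → unc-just {φ} (unc i) eqh }) , _ , ed-incʳ i , inch) eqg eqh

      -- Cycles of length at least four

      module LongCycle (1≤r : 1 ≤ r) where

        degree≤2+k : ∀ i → degree G (v (1 + i)) ≤ 2 + k
        degree≤2+k i = ℕ.≤-trans (ℕ.≤-reflexive (degree-split (v (1 + i)))) (ℕ.+-mono-≤
          (count-≤-length (uncAt? φ (v (1 + i))) (ed i ∷ ed (1 + i) ∷ []) λ e (inc , ue) →
            Sum.[ here , there ∘ here ]′ (onCycle-at i (uncoloured-on-cycle 1≤r i ue inc) inc))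
          (bounded (unc (1 + i)) (ed-incˡ (1 + i))))

        -- `degree-large` asks for `k + 1 + mult` edges at a vertex that has at most `2 + k`: two
        -- cycle edges and the coloured ones.
        mult≤1 : ∀ i → mult G (v (1 + i)) (v (2 + i)) ≤ 1
        mult≤1 i = ℕ.+-cancelˡ-≤ (suc k) _ _ (ℕ.≤-trans (degree-large (unc (1 + i)) (joins (1 + i)))
          (ℕ.≤-trans (degree≤2+k i) (ℕ.≤-reflexive (cong suc (ℕ.+-comm 1 k)))))

        parallel : ∀ i {g} → Inc G g (v (1 + i)) → Inc G g (v (2 + i)) → g ≡ ed (1 + i)
        parallel i {g} inc₁ inc₂ = decidable-stable (g Fin.≟ ed (1 + i)) λ g≢ → ℕ.<⇒≱
          (length-≤-count (inc₂? (v (1 + i)) (v (2 + i))) ((g≢ ∷ []) ∷ [] ∷ [])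
            ((inc₁ , inc₂) ∷ (ed-incˡ (1 + i) , ed-incʳ (1 + i)) ∷ []))
          (subst (_≤ 1) (mult≡ _ _) (mult≤1 i))

        -- Edges of colour `c` at both ends of `ed (1 + i)` coincide by `no-repeat`. The common edge
        -- is parallel to `ed (1 + i)`, hence equal to it, but `ed (1 + i)` is uncoloured.
        seen-clash : ∀ i {c} → Seen c (1 + i) → ¬ Seen c (2 + i)
        seen-clash i (g , incg , eqg) (h , inch , eqh) with refl ← seen-both (1 + i) incg eqg inch eqh
          with refl ← parallel i incg inch = unc-just {φ} (unc (1 + i)) eqg

        -- The colour is blocked at `ed (1 + i)`, hence at `ed (2 + i)`, hence seen at an end of
        -- `ed (2 + i)`; the nearer end is excluded by `seen-clash`.
        seen-next : ∀ i {c} → Seen c (1 + i) → Seen c (3 + i)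
        seen-next i seen with ¬free⇒∃ (seen-blocks i seen ∘ free-prev i)
        ... | h , (_ , _ , inc₂ , inc) , eq with Joins-ends (joins (2 + i)) inc₂
        ...   | inj₁ refl = contradiction (h , inc , eq) (seen-clash i seen)
        ...   | inj₂ refl = h , inc , eq

        seen-even : ∀ t i {c} → Seen c (1 + i) → Seen c (1 + (t + t + i))
        seen-even zero    i seen = seen
        seen-even (suc t) i {c} seen =
          subst (Seen c) (cong (λ x → 2 + (x + i)) (sym (ℕ.+-suc t t))) (seen-next (t + t + i) (seen-even t i seen))

        -- `suc t` steps of two exceed the odd length by one, so a colour seen at a vertex would
        -- also be seen at the next vertex.
        odd⇒nothing-seen : ∀ {t} → 3 + r ≡ suc (t + t) → ∀ i {c} → ¬ Seen c (1 + i)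
        odd⇒nothing-seen {t} odd i {c} seen = seen-clash i seen
          (subst (λ x → ∃ λ g → Inc G g x × φ g ≡ just c) (v-period (2 + i))
            (subst (Seen c) shift (seen-even (suc t) i seen)))
          where
          shift : 1 + (suc t + suc t + i) ≡ 3 + r + (2 + i)
          shift = begin
            2 + (t + suc t + i)       ≡⟨ cong (λ x → 2 + (x + i)) (ℕ.+-suc t t) ⟩
            2 + (suc (t + t) + i)     ≡⟨ cong (λ x → 2 + (x + i)) odd ⟨
            2 + (3 + r + i)           ≡⟨ cong suc (ℕ.+-suc (3 + r) i) ⟨
            1 + (3 + r + (1 + i))     ≡⟨ ℕ.+-suc (3 + r) (1 + i) ⟨
            3 + r + (2 + i)           ∎
            where open ≡-Reasoning

        module Alternating (half : ℕ) (even : 3 + r ≡ half + half) {a b : Fin K} (a≢b : a ≢ b)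
          (free-a : Free φ (ed 1) a) (free-b : Free φ (ed 1) b) where

          col : ℕ → Fin K
          col zero          = a
          col (suc zero)    = b
          col (suc (suc i)) = col i

          col-suc : ∀ i → col (suc i) ≢ col i
          col-suc zero    eq = a≢b (sym eq)
          col-suc (suc i) eq = col-suc i (sym eq)

          col-even : ∀ t i → col (t + t + i) ≡ col i
          col-even zero    i = refl
          col-even (suc t) i = trans (cong (λ x → col (suc (x + i))) (ℕ.+-suc t t)) (col-even t i)

          col-free : ∀ s j → Free φ (ed j) (col s)
          col-free zero          j = free-everywhere j free-a
          col-free (suc zero)    j = free-everywhere j free-b
          col-free (suc (suc s)) j = col-free s j

          position? : ∀ f → Dec (∃ λ (s : Fin (3 + r)) → f ≡ ed (toℕ s + 0))
          position? f = Fin.any? λ s → f Fin.≟ ed (toℕ s + 0)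

          ψ : Partial
          ψ f with position? f
          ... | yes (s , _) = just (col (toℕ s))
          ... | no _        = φ f

          ψ-cases : ∀ f → (∃ λ s → s < 3 + r × f ≡ ed (s + 0) × ψ f ≡ just (col s)) ⊎ (¬ OnCycle f × ψ f ≡ φ f)
          ψ-cases f with position? f
          ... | yes (s , eq) = inj₁ (toℕ s , Fin.toℕ<n s , eq , refl)
          ... | no ¬on       = inj₂ ((λ { (j , refl) → let (s , s<ℓ , eq) = ed-cover 0 j in
            ¬on (fromℕ< s<ℓ , trans eq (cong (λ x → ed (x + 0)) (sym (Fin.toℕ-fromℕ< s<ℓ)))) }) , refl)

          col-adj : ∀ {s t} → s < t → t < 3 + r → AdjL G (ed (s + 0)) (ed (t + 0)) → col s ≢ col t
          col-adj {s} {t} s<t t<ℓ adj eq = differ (ed-adj⁻ (s + 0) {t ∸ s} (ℕ.m<n⇒0<n∸m s<t)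
              (ℕ.≤-<-trans (ℕ.m∸n≤m t s) t<ℓ) (subst (λ x → AdjL G (ed (s + 0)) (ed x)) t≡ adj))
            where
            d = t ∸ s
            d+s≡t : d + s ≡ t
            d+s≡t = ℕ.m∸n+n≡m (ℕ.<⇒≤ s<t)
            t≡ : t + 0 ≡ d + (s + 0)
            t≡ = trans (cong (_+ 0) (sym d+s≡t)) (ℕ.+-assoc d s 0)
            differ : d ≡ 1 ⊎ suc d ≡ 3 + r → ⊥
            differ (inj₁ d≡1) = col-suc s (trans (cong (λ x → col (x + s)) (sym d≡1)) (trans (cong col d+s≡t) (sym eq)))
            -- The pair that closes the cycle: `suc t` is `s` plus the even length, so `col (suc t)`
            -- equals `col s`.
            differ (inj₂ 1+d≡ℓ) = col-suc t (trans (cong (col ∘ suc) (sym d+s≡t))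
              (trans (cong (λ x → col (x + s)) (trans 1+d≡ℓ even)) (trans (col-even half s) eq)))

          ψ-proper : Proper ψ
          ψ-proper {e} {f} adj eqe eqf with ψ-cases e | ψ-cases f
          ... | inj₂ (_ , e-off) | inj₂ (_ , f-off) = proper adj (trans (sym e-off) eqe) (trans (sym f-off) eqf)
          ... | inj₁ (s , _ , refl , e-on) | inj₂ (_ , f-off) = col-free s (s + 0) f adj
            (trans (sym f-off) (trans eqf (trans (sym eqe) e-on)))
          ... | inj₂ (_ , e-off) | inj₁ (s , _ , refl , f-on) = col-free s (s + 0) e (adjL-sym adj)
            (trans (sym e-off) (trans eqe (trans (sym eqf) f-on)))
          ... | inj₁ (s , s<ℓ , refl , e-on) | inj₁ (t , t<ℓ , refl , f-on) with ℕ.<-cmp s t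
          ...   | tri< s<t _ _ = col-adj s<t t<ℓ adj (just-injective (trans (sym e-on) (trans eqe (trans (sym eqf) f-on))))
          ...   | tri≈ _ refl _ = adjL-irrefl adj
          ...   | tri> _ _ t<s = col-adj t<s s<ℓ (adjL-sym adj) (just-injective (trans (sym f-on) (trans eqf (trans (sym eqe) e-on))))

          progress : Progress φ
          progress = record
            { X = arc 0 (2 + r)
            ; unc = arc-unc 0 (2 + r)
            ; start = ed 0
            ; start∈X = ∈-arc⁺ 0 (2 + r) {0} z≤n
            ; closed = λ e∈ (_ , x , ince , incf) uf → let (s , _ , eq) = ∈-arc⁻ 0 (2 + r) e∈ in
                ∈-full-arc 0 (closed (s + 0) (subst (λ e → Inc G e x) eq ince) incf uf)
            ; completion = record
              { colouring = ψ ; proper = λ {e} {f} {c} → ψ-proper {e} {f} {c} ; on = λ {e} → on {e} ; off = off }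
            }
            where
            at : ∀ j {f} → Unc φ f → Inc G f (v j) → OnCycle f
            at j uf inc = uncoloured-on-cycle 1≤r (2 + r + j) uf (subst (Inc G _) (v-pred j) inc)
            closed : ∀ i {x f} → Inc G (ed i) x → Inc G f x → Unc φ f → OnCycle f
            closed i inc₁ inc uf with Joins-ends (joins i) inc₁
            ... | inj₁ refl = at i uf inc
            ... | inj₂ refl = at (1 + i) uf inc
            on : ∀ {e} → e ∈ arc 0 (2 + r) → ¬ Unc ψ e
            on {e} e∈ ue with ψ-cases e
            ... | inj₁ (_ , _ , _ , eq) = unc-just {ψ} {e} ue eq
            ... | inj₂ (e∉ , _) = e∉ (let (s , _ , eq) = ∈-arc⁻ 0 (2 + r) e∈ in s + 0 , eq)
            off : ∀ {e} → e ∉ arc 0 (2 + r) → ψ e ≡ φ e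
            off {e} e∉ with ψ-cases e
            ... | inj₁ (s , _ , eq , _) = contradiction (∈-full-arc 0 (s + 0 , eq)) e∉
            ... | inj₂ (_ , eq) = eq

        -- On an even cycle `ed 1` has two uncoloured neighbours, hence two free colours. These are
        -- free along the whole cycle and colour it alternately, which is progress.
        odd-length : ∃ λ t → 3 + r ≡ suc (t + t)
        odd-length with parity (3 + r)
        ... | t , inj₂ odd  = t , odd
        ... | t , inj₁ even =
          let (a , b , a≢b , free-a , free-b) = 2≤count⇒∃ (free? φ (ed 1)) (ℕ.≤-trans
                (length-≤-count (uncNbr? φ (ed 1))
                  (((λ eq → ed-distinct 0 {2} z<s (s<s (s<s z<s)) (sym eq)) ∷ []) ∷ [] ∷ [])
                  ((ed-adj 0 , unc 0) ∷ (adjL-sym (ed-adj 1) , unc 2) ∷ []))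
                (uncNbrs≤freeColours φ (ed 1)))
          in contradiction (Alternating.progress t even a≢b free-a free-b) stuck

        -- A coloured edge here would make its colour seen at a vertex of an odd cycle, so the edge
        -- is uncoloured and thus on the cycle.
        edge-at : (∃ λ t → 3 + r ≡ suc (t + t)) → ∀ i {e} → Inc G e (v (1 + i)) → e ≡ ed i ⊎ e ≡ ed (1 + i)
        edge-at (t , odd) i {e} inc = onCycle-at i (uncoloured-on-cycle 1≤r i
          (decidable-stable (unc? φ e) λ ¬unc → let (c , eq) = coloured {φ} ¬unc in
            odd⇒nothing-seen {t} odd i (e , inc , eq)) inc) inc

        exceptionA : Connected G → ExceptionA G k
        exceptionA connected = k≡0 , WC.simple , WC.isCycle , proj₁ odd-length , trans WC.n≡length (proj₂ odd-length)
          where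
          module WC = WholeCycle connected (edge-at odd-length)

          -- Only two edges meet `v 1`, whereas `degree-large` demands at least `k + 2`.
          k≡0 : k ≡ 0
          k≡0 = ℕ.n≤0⇒n≡0 (ℕ.+-cancelʳ-≤ 2 k 0 (begin
            k + 2                         ≡⟨ ℕ.+-suc k 1 ⟩
            suc (k + 1)                   ≤⟨ s≤s (ℕ.+-monoʳ-≤ k (1≤mult 1)) ⟩
            suc (k + mult G (v 1) (v 2))  ≤⟨ degree-large (unc 1) (joins 1) ⟩
            degree G (v 1)                ≡⟨ degree≡ (v 1) ⟩
            count (λ e → inc? e (v 1))    ≤⟨ count-≤-length (λ e → inc? e (v 1)) (ed 0 ∷ ed 1 ∷ [])
                                              (λ e inc → Sum.[ here , there ∘ here ]′ (edge-at odd-length 0 inc)) ⟩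
            2                             ∎))
            where open ℕ.≤-Reasoning

      -- Triangles

      module Triangle (r≡0 : r ≡ 0) where

        -- If `g` has colour `c`, then `c` is blocked at `ed (1 + i)`, hence at the opposite edge
        -- `ed (2 + i)`, so an edge `h` of colour `c` meets one of its ends. Both `g` and `h` meet
        -- the uncoloured triangle edge from `v (1 + i)` to that end, so they are equal by
        -- `no-repeat`.
        edge-in-triangle : ∀ i {g} → Inc G g (v (1 + i)) → Inc G g (v (2 + i)) ⊎ Inc G g (v (3 + i))
        edge-in-triangle i {g} inc with unc? φ g
        ... | yes ug with Inc⇒Joins inc
        ...   | w , j = Sum.map (λ { refl → Joins⇒Incʳ j }) (λ { refl → Joins⇒Incʳ j }) (uncoloured-in-triangle r≡0 i ug j)
        edge-in-triangle i {g} inc | no ¬ug with coloured {φ} ¬ug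
        ...   | c , eq with ¬free⇒∃ (seen-blocks i (g , inc , eq) ∘ free-prev i)
        ...     | h , (_ , _ , inc₂ , inch) , eqh with Joins-ends (joins (2 + i)) inc₂
        ...       | inj₁ refl = inj₁ (subst (λ e → Inc G e _) (sym (seen-both (1 + i) inc eq inch eqh)) inch)
        ...       | inj₂ refl = inj₂ (subst (λ e → Inc G e _)
          (seen-both i (subst (Inc G h) (triangle-period r≡0 i) inch) eqh inc eq) inch)

        v₂≢v₃ : ∀ i → v (2 + i) ≢ v (3 + i)
        v₂≢v₃ i = distinct (2 + i) {1} z<s (s<s z<s) ∘ sym

        v₁≢v₂ : ∀ i → v (1 + i) ≢ v (2 + i)
        v₁≢v₂ i = distinct (1 + i) {1} z<s (s<s z<s) ∘ sym

        v₁≢v₃ : ∀ i → v (1 + i) ≢ v (3 + i)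
        v₁≢v₃ i = distinct (1 + i) {2} z<s (s<s (s<s z<s)) ∘ sym

        degree-triangle : ∀ i → degree G (v (1 + i)) ≡ mult G (v (1 + i)) (v (2 + i)) + mult G (v (1 + i)) (v (3 + i))
        degree-triangle i = begin
          degree G x                                   ≡⟨ degree≡ x ⟩
          count (λ e → inc? e x)                       ≡⟨ count-split (λ e → inc? e x) (λ e → inc? e y) ⟩
          count (inc₂? x y) + count not-y?             ≡⟨ cong (count (inc₂? x y) +_) (ℕ.≤-antisym
            (count-mono not-y? (inc₂? x z) λ e (incx , ¬incy) →
              incx , Sum.[ (λ incy → contradiction incy ¬incy) , id ]′ (edge-in-triangle i incx))
            (count-mono (inc₂? x z) not-y? λ e (incx , incz) → incx , λ incy →
              Sum.[ v₁≢v₂ i ∘ sym , v₂≢v₃ i ]′ (Joins-ends (Inc₂⇒Joins (v₁≢v₃ i) incx incz) incy))) ⟩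
          count (inc₂? x y) + count (inc₂? x z)        ≡⟨ cong₂ _+_ (mult≡ x y) (mult≡ x z) ⟨
          mult G x y + mult G x z                      ∎
          where
          open ≡-Reasoning
          x = v (1 + i)
          y = v (2 + i)
          z = v (3 + i)
          not-y? : ∀ e → Dec (Inc G e x × ¬ Inc G e y)
          not-y? e = inc? e x ×-dec ¬? (inc? e y)

        exceptionB : Connected G → ExceptionB G k
        exceptionB connected = trans n≡length (cong (3 +_) r≡0) , x , y , z , v₁≢v₂ 0 , v₁≢v₃ 0 , v₂≢v₃ 0
          , 1≤mult 1 , subst (1 ≤_) (trans (cong (mult G z) v₄≡x) (mult-sym z x)) (1≤mult 3) , 1≤mult 2
          , excess-of-triangle equation (subst (_≤ Δ G) dx (degree≤Δ x)) (subst (_≤ Δ G) dy (degree≤Δ y))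
              (subst (_≤ Δ G) dz (degree≤Δ z)) maximum
          where
          x = v 1
          y = v 2
          z = v 3
          v₄≡x : v 4 ≡ x
          v₄≡x = triangle-period r≡0 1
          v₅≡y : v 5 ≡ y
          v₅≡y = triangle-period r≡0 2
          closed : ∀ j {e w} → Joins e (v (1 + j)) w → ∃ λ i → w ≡ v i
          closed j joined with edge-in-triangle j (Joins⇒Incˡ joined)
          ... | inj₁ inc = 2 + j , Sum.[ (λ eq → contradiction (sym eq) (v₁≢v₂ j)) , sym ]′ (Joins-ends joined inc)
          ... | inj₂ inc = 3 + j , Sum.[ (λ eq → contradiction (sym eq) (v₁≢v₃ j)) , sym ]′ (Joins-ends joined inc)
          open Spanning connected closed
          a = mult G x y
          b = mult G y z
          c = mult G x z
          dx : degree G x ≡ a + c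
          dx = degree-triangle 0
          dy : degree G y ≡ b + a
          dy = trans (degree-triangle 1) (cong (b +_) (trans (cong (mult G y) v₄≡x) (mult-sym y x)))
          dz : degree G z ≡ c + b
          dz = trans (degree-triangle 2) (cong₂ _+_ (trans (cong (mult G z) v₄≡x) (mult-sym z x))
                                                    (trans (cong (mult G z) v₅≡y) (mult-sym z y)))
          equation : suc (Δ G + k + a) ≡ a + c + (b + a)
          equation = trans (cong (λ d → suc (d + a)) (sym (degreeL-tight (unc 1))))
                           (trans (degreeL-formula (joins 1)) (cong₂ _+_ dx dy))
          maximum : Δ G ≡ a + c ⊎ Δ G ≡ b + a ⊎ Δ G ≡ c + b
          maximum with Δ-attained x
          ... | u , eq with spanning u
          -- Positions are counted from 0, and `v 0` is the same vertex as `z`, which is `v 3`.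
          ...   | 0 , _ , refl = inj₂ (inj₂ (trans (sym eq) (trans (cong (degree G) (sym (triangle-period r≡0 0))) dz)))
          ...   | 1 , _ , refl = inj₁ (trans (sym eq) dx)
          ...   | 2 , _ , refl = inj₂ (inj₁ (trans (sym eq) dy))
          ...   | suc (suc (suc s)) , s<ℓ , _ with () ← ℕ.m<n⇒n≢0 (ℕ.s≤s⁻¹ (ℕ.s≤s⁻¹ (ℕ.s≤s⁻¹ s<ℓ))) r≡0

    exception : Connected G → ∀ {e} → Unc φ e → ExceptionA G k ⊎ ExceptionB G k
    exception connected ue with exists-cycle continue ue
    ... | C with Cycle.r C ℕ.≟ 0
    ...   | yes r≡0 = inj₂ (OnUncolouredCycle.Triangle.exceptionB C r≡0 connected)
    ...   | no r≢0  = inj₁ (OnUncolouredCycle.LongCycle.exceptionA C (ℕ.n≢0⇒n>0 r≢0) connected)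

  -- A newly coloured edge lies in the closed set. If it met `e`, then `e` would lie there as well
  -- and be coloured. So no edge at `v` has been newly coloured.
  Bounded-completion : ∀ {φ} → Bounded φ → (P : Progress φ) → Bounded (Completion.colouring (Progress.completion P))
  Bounded-completion {φ} bounded P {e} {v} ue inc = ℕ.≤-trans
    (count-mono (colouredAt? ψ v) (colouredAt? φ v) λ g (incg , ¬ug) → incg , λ ug →
      ¬ug (trans (off λ g∈X → on⇒∉ ue (closed g∈X (g≢e ¬ug , v , incg , inc) (unc⇒unc ue))) ug))
    (bounded (unc⇒unc ue) inc)
    where
    open Progress P using (closed)
    open Completion (Progress.completion P) renaming (colouring to ψ)
    g≢e : ∀ {g} → ¬ Unc ψ g → g ≢ e
    g≢e ¬ug refl = ¬ug ue

  -- Extending the precolouring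

  Colouring : Partial → (Fin m → Fin K) → Set
  Colouring pc c = ProperColouring G K c × Extends G K pc c

  -- As the existence of a colouring is decidable, it may be proved by
  -- contradiction, in which case no partial colouring admits progress.
  extension : Connected G → ¬ ExceptionA G k → ¬ ExceptionB G k → ∀ {pc} → Proper pc → Bounded pc → ∃ (Colouring pc)
  extension connected ¬A ¬B {pc} proper bounded = decidable-stable
    (anyFunction? {Q = Colouring pc} respects colouring?)
    λ ¬c → refute ¬c _ proper (λ _ _ eq → eq) bounded (ℕ.n<1+n _)
    where
    respects : ∀ {c d} → c ≗ d → Colouring pc c → Colouring pc d
    respects c≗d (proper , extends) =
      (λ e f adj eq → proper e f adj (trans (c≗d e) (trans eq (sym (c≗d f)))))
      , λ e a eq → trans (sym (c≗d e)) (extends e a eq)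

    colouring? : ∀ c → Dec (Colouring pc c)
    colouring? c = (Fin.all? λ e → Fin.all? λ f → adjL? e f →-dec ¬? (c e Fin.≟ c f))
      ×-dec (Fin.all? λ e → Fin.all? λ a → has? pc e a →-dec (c e Fin.≟ a))

    -- Induction on a bound `N` for the number of uncoloured edges. Progress would lead to a partial
    -- colouring with fewer of them, so there is none and an exception holds; with no uncoloured
    -- edge left, the colouring is total.
    refute : ¬ ∃ (Colouring pc) → ∀ N {φ} → Proper φ → (∀ e c → pc e ≡ just c → φ e ≡ just c) → Bounded φ →
             count (unc? φ) < N → ⊥
    refute ¬c (suc N) {φ} proper extends bounded bound with Fin.any? (unc? φ)
    ... | yes (e , ue) = Sum.[ ¬A , ¬B ]′ (exception proper bounded stuck connected ue)
      where
      stuck : ¬ Progress φ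
      stuck P = refute ¬c N C.proper
        -- Precoloured edges are coloured by `φ`, so they lie outside the uncoloured set `P.X` and
        -- keep their colours.
        (λ e c eq → trans (C.off λ e∈X → unc-just {φ} {e} (All.lookup P.unc e∈X) (extends e c eq)) (extends e c eq))
        (Bounded-completion bounded P)
        (ℕ.<-≤-trans (count-mono-< (unc? C.colouring) (unc? φ) (λ _ → C.unc⇒unc) P.start (C.on P.start∈X)
          (All.lookup P.unc P.start∈X)) (ℕ.s≤s⁻¹ bound))
        where
        module P = Progress P
        module C = Completion P.completion
    ... | no total = ¬c ((λ e → proj₁ (colour e))
        , (λ e f adj eq → proper adj (proj₂ (colour e)) (trans (proj₂ (colour f)) (cong just (sym eq))))
        , λ e a eq → just-injective (trans (sym (proj₂ (colour e))) (extends e a eq)))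
      where
      colour : ∀ e → ∃ λ c → φ e ≡ just c
      colour e = coloured {φ} λ ue → total (e , ue)

theorem1p8 : (G : Multigraph) → Connected G → (k : ℕ) → ΔL G ≤ Δ G + k →
    (pc : Fin (Multigraph.m G) → Maybe (Fin (Δ G + k))) →
    ProperPrecolouring G (Δ G + k) pc → SBounded G (Δ G + k) k pc →
    ¬ ExceptionA G k → ¬ ExceptionB G k →
    Σ (Fin (Multigraph.m G) → Fin (Δ G + k)) λ c →
    ProperColouring G (Δ G + k) c × Extends G (Δ G + k) pc c
theorem1p8 G connected k ΔL≤ pc proper bounded ¬A ¬B = extension connected ¬A ¬B
  (λ {e} {f} {c} adj eqe eqf → proper e f c c adj eqe eqf refl)
  -- The coloured edges of the initial partial colouring are exactly those of the set S, so the
  -- given bound is the initial case of `Bounded`.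
  (λ {_} {v} _ _ → subst (_≤ k) (countE≡count _ (colouredAt? pc v) λ e →
    cong₂ _∧_ (incᵇ≡ e v) (is-just≡ e)) (bounded v))
  where
  open GraphFacts G
  open Stuck G k ΔL≤
  is-just≡ : ∀ e → is-just (pc e) ≡ does (¬? (unc? pc e))
  is-just≡ e with pc e
  ... | just _  = refl
  ... | nothing = refl
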